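{- Let $G$ be a countably infinite locally finite abelian group (written additively), and let $G_\bullet=(G_i)_{i\ge1}$ be any filtration of $G$ by finite subgroups. If $A\subseteq G$ satisfies $\overline d_{G_\bullet}(\mathcal P(A))>0$, then there exists an infinite set $B\subseteq\mathcal P(A)$ such that $$B+B\subseteq\mathcal P(A).$$
   Context: An abelian group is locally finite if every finitely generated subgroup is finite. A filtration of $G$ by finite subgroups is a chain $G_1\le G_2\le\cdots$ of finite subgroups with $\bigcup_{i\ge1}G_i=G$. For $A\subseteq G$, $\mathcal P(A):=\{\sum_{a\in F}a : F\subseteq A,\ |F|<\infty\}$ is the set of finite subset sums, including the empty sum $0$. For $S\subseteq G$, $\overline d_{G_\bullet}(S):=\limsup_{i\to\infty}|S\cap G_i|/|G_i|$. For $B\subseteq G$, $B+B:=\{b+b':b,b'\in B\}$ (with $b=b'$ allowed). -}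

module Defs where

open import Algebra.Bundles using (AbelianGroup)
open import Data.Integer.Base as ℤ using ()
open import Data.List.Base using (List; _∷_; foldr; filter; length)
open import Data.List.Relation.Unary.All using (All)
import Data.List.Membership.Setoid as Membership
import Data.List.Relation.Unary.Unique.Setoid as Uniqueness
open import Data.Nat.Base as ℕ using (ℕ; suc; NonZero)
open import Data.Product.Base using (_×_; ∃; ∃₂)
open import Data.Rational.Unnormalised.Base as ℚᵘ using (ℚᵘ; _/_)
open import Function.Bundles using (Bijection; _⇔_; Equivalence)
open import Level using (Level; _⊔_; 0ℓ) renaming (suc to lsuc)
open import Relation.Binary.Definitions using (_Respects_)
import Relation.Binary.PropositionalEquality as ≡
open import Relation.Nullary.Negation using (¬_)
open import Relation.Unary using (Pred; Decidable; _⊆_)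

private
  variable
    p q : Level

-- An extended real number, given by its lower Dedekind cut: the predicate
-- holds of the rationals strictly below the number.
LowerReal : Set₁
LowerReal = Pred ℚᵘ 0ℓ

infix 4 _<ᴿ_
_<ᴿ_ : ℚᵘ → LowerReal → Set
r <ᴿ x = x r

fromℚᵘ : ℚᵘ → LowerReal
fromℚᵘ s r = r ℚᵘ.< s

sup : (ℕ → LowerReal) → LowerReal
sup x r = ∃ λ n → r <ᴿ x n

-- The rational s keeps the cut open: r may lie below every x n and still be
-- equal to their infimum.
inf : (ℕ → LowerReal) → LowerReal
inf x r = ∃ λ s → r ℚᵘ.< s × (∀ n → s <ᴿ x n)

limsup : (ℕ → ℚᵘ) → LowerReal
limsup u = inf λ n → sup λ k → fromℚᵘ (u (n ℕ.+ k))

-- Subsets of G are predicates on the carrier; equality in G is _≈_, so a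
-- predicate is a genuine subset when it respects _≈_.
module Additive {c ℓ} (G : AbelianGroup c ℓ) where

  open AbelianGroup G public
    using (Carrier; _≈_; setoid)
    renaming (_∙_ to infixl 6 _+_; ε to 0#; _⁻¹ to infix 8 -_)
  open Membership setoid public using (_∈_)
  open Uniqueness setoid public using (Unique)

  record Finite (S : Pred Carrier p) : Set (c ⊔ ℓ ⊔ p) where
    field
      elements : List Carrier
      unique   : Unique elements
      complete : ∀ x → S x ⇔ x ∈ elements

  Infinite : Pred Carrier p → Set (c ⊔ ℓ ⊔ p)
  Infinite S = ¬ Finite S

  CountablyInfinite : Set (c ⊔ ℓ)
  CountablyInfinite = Bijection (≡.setoid ℕ) setoid

  record Subgroup p : Set (c ⊔ ℓ ⊔ lsuc p) where
    field
      member    : Pred Carrier p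
      respects  : member Respects _≈_
      0-closed  : member 0#
      +-closed  : ∀ {x y} → member x → member y → member (x + y)
      neg-closed : ∀ {x} → member x → member (- x)

  -- ⟨ xs ⟩ is the subgroup generated by the entries of xs.
  data ⟨_⟩ (xs : List Carrier) : Pred Carrier (c ⊔ ℓ) where
    generator : ∀ {x} → x ∈ xs → ⟨ xs ⟩ x
    zero      : ⟨ xs ⟩ 0#
    add       : ∀ {x y} → ⟨ xs ⟩ x → ⟨ xs ⟩ y → ⟨ xs ⟩ (x + y)
    neg       : ∀ {x} → ⟨ xs ⟩ x → ⟨ xs ⟩ (- x)
    resp      : ∀ {x y} → x ≈ y → ⟨ xs ⟩ x → ⟨ xs ⟩ y

  LocallyFinite : Set (c ⊔ ℓ)
  LocallyFinite = ∀ xs → Finite ⟨ xs ⟩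

  -- Indexing starts at 0: term i is the group usually written G_{i+1}.
  record Filtration p : Set (c ⊔ ℓ ⊔ lsuc p) where
    field
      term      : ℕ → Subgroup p
      finite    : ∀ i → Finite (Subgroup.member (term i))
      ascending : ∀ i → Subgroup.member (term i) ⊆ Subgroup.member (term (suc i))
      exhaustive : ∀ x → ∃ λ i → Subgroup.member (term i) x

    elements : ℕ → List Carrier
    elements i = Finite.elements (finite i)

    order : ℕ → ℕ
    order i = length (elements i)

    order-nonZero : ∀ i → NonZero (order i)
    order-nonZero i = nonEmpty
      (Equivalence.to (Finite.complete (finite i) 0#) (Subgroup.0-closed (term i)))
      where
      nonEmpty : ∀ {x xs} → x ∈ xs → NonZero (length xs)
      nonEmpty {xs = _ ∷ _} _ = _

  sum : List Carrier → Carrier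
  sum = foldr _+_ 0#

  𝒫 : Pred Carrier p → Pred Carrier (c ⊔ ℓ ⊔ p)
  𝒫 A x = ∃ λ F → Unique F × All A F × x ≈ sum F

  infixl 6 _⊕_
  _⊕_ : Pred Carrier p → Pred Carrier q → Pred Carrier (c ⊔ ℓ ⊔ p ⊔ q)
  (B ⊕ C) x = ∃₂ λ b b′ → B b × C b′ × x ≈ b + b′

  -- The decision procedure only serves to count the elements of S in each
  -- (finite, duplicate-free) list of elements of a term of the filtration.
  upperDensity : Filtration q → {S : Pred Carrier p} → Decidable S → LowerReal
  upperDensity G• S? = limsup λ i →
    _/_ (ℤ.+ length (filter S? (elements i))) (order i) ⦃ order-nonZero i ⦄
    where open Filtration G•

{-# OPTIONS --safe #-}

-- It suffices to find, beyond every finite part of A and outside every G_j, some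
-- x ∈ 𝒫(A) with 2x ∈ 𝒫(A): choosing such x's on disjoint supports, sums of two
-- different ones lie in 𝒫(A) automatically.
--
-- Fix a finite subgroup K and a tail A′ of A, and suppose that, modulo K, x and
-- 2x both lie in 𝒫(A′) only for x = 0.  If y + w = w′ for sums over Y, W, W′ ⊆ A′,
-- write v = 1_Y + 1_W - 1_W′ = 2·1_{v≥1} - 1_{v=±1}; then the sums over {v = 1},
-- {v = 2} and {v = -1} all vanish.  So the subsets of A′ with sum 0 are closed
-- under differences, and one can choose z₀, z₁, … in A′ such that any zero-sum
-- set containing z_t has a zero-sum subset containing z_t and no other z_s.
-- For Y = {z_a, …, z_b}, with sum y:
--   * 2y + w = w′ is impossible for w, w′ ∈ 𝒫(A′ ∖ Y), so 𝒫(A′ ∖ Y) has as many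
--     disjoint translates as Y has elements;
--   * if y + w = w′ then w ∈ 𝒫(A′ ∖ Y), so the elements of 𝒫(A′) outside
--     𝒫(A′ ∖ Y) for q consecutive blocks Y have q disjoint translates.
-- Hence 𝒫(A′) would have density zero, and so would 𝒫(A).
--
-- Therefore every K and every tail admit x ∉ K with 2x ∈ 𝒫(A′) + K.  Two
-- applications of the pigeonhole principle to the error term in K turn this
-- into 2x ∈ 𝒫(A′) with x outside any prescribed G_j.
module Submission where

open import Defs
open import Algebra.Bundles using (AbelianGroup)
import Algebra.Properties.AbelianGroup as AbelianGroupProperties
import Algebra.Properties.Group as GroupProperties
import Algebra.Solver.CommutativeMonoid as MonoidSolver
open import Axiom.ExcludedMiddle using (ExcludedMiddle)
open import Data.Bool.Base using (Bool; true; false; T; not; _∧_; _∨_; _xor_)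
open import Data.Bool.Properties using (T?; T-≡)
open import Data.Empty using (⊥; ⊥-elim)
open import Data.Fin.Base as Fin using (Fin)
import Data.Fin.Properties as Finₚ
import Data.Integer.Base as ℤ
import Data.Integer.Properties as ℤₚ
open import Data.List.Base using (List; []; _∷_; length; filter; lookup)
import Data.List.Membership.Setoid as Membership
import Data.List.Membership.Setoid.Properties as Membershipₚ
import Data.List.Properties as Listₚ
open import Data.List.Relation.Unary.All as All using (All; []; _∷_)
open import Data.List.Relation.Unary.AllPairs using ([]; _∷_)
open import Data.List.Relation.Unary.Any as Any using (Any; here; there)
import Data.List.Relation.Unary.Any.Properties as Anyₚ
import Data.List.Relation.Unary.Unique.Setoid.Properties as Uniqueₚ
open import Data.Nat.Base as ℕ using (ℕ; zero; suc; z≤n; s≤s)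
import Data.Nat.Properties as ℕₚ
open import Data.Product.Base using (_×_; _,_; proj₁; proj₂; ∃; Σ-syntax; uncurry)
open import Data.Rational.Unnormalised.Base as ℚᵘ using (0ℚᵘ; mkℚᵘ; *<*)
open import Data.Sum.Base using (_⊎_; inj₁; inj₂)
open import Data.Unit.Base using (tt)
open import Function.Base using (_∘_; id)
open import Function.Definitions using (Injective; StrictlySurjective)
open import Function.Bundles using (Equivalence; Bijection)
open import Level using (0ℓ; _⊔_; Lift; lift; lower)
open import Relation.Binary.Definitions using (tri<; tri≈; tri>; _Respects_)
open import Relation.Binary.PropositionalEquality as ≡ using (_≡_)
open import Relation.Nullary.Decidable
  using (Dec; yes; no; True; map′; decidable-stable; toWitness; fromWitness)
open import Relation.Nullary.Negation using (¬_; contradiction)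
open import Relation.Unary using (Pred; Decidable; _⊆_)

-- Finite sets of indices

-- A characteristic function with an upper bound that need not be sharp, so that identities between
-- sets reduce to checks on truth values.
record FinSet : Set where
  field
    has    : ℕ → Bool
    bound  : ℕ
    beyond : ∀ {k} → bound ℕ.≤ k → has k ≡ false

open FinSet

infix 4 _∋_ _⊑_
infixr 6 _∪_
infixl 7 _∖_ _∩_

_∋_ : FinSet → Pred ℕ 0ℓ
X ∋ k = T (has X k)

_⊑_ : FinSet → Pred ℕ 0ℓ → Set
X ⊑ A = ∀ {k} → X ∋ k → A k

Disjoint : FinSet → FinSet → Set
Disjoint X Y = ∀ {k} → X ∋ k → Y ∋ k → ⊥

∋⇒< : ∀ X {k} → X ∋ k → k ℕ.< bound X
∋⇒< X {k} k∈X = ℕₚ.≰⇒> λ X≤k → ≡.subst T (beyond X X≤k) k∈X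

-- Ternary because the level sets of 1_Y + 1_W - 1_W′ depend on three sets; the binary operations
-- pass `∅` as the third.
combine : (f : Bool → Bool → Bool → Bool) → f false false false ≡ false →
          FinSet → FinSet → FinSet → FinSet
combine f f≡false X Y Z = record
  { has    = λ k → f (has X k) (has Y k) (has Z k)
  ; bound  = bound X ℕ.⊔ (bound Y ℕ.⊔ bound Z)
  ; beyond = outside
  }
  where
  outside : ∀ {k} → bound X ℕ.⊔ (bound Y ℕ.⊔ bound Z) ℕ.≤ k →
            f (has X k) (has Y k) (has Z k) ≡ false
  outside b≤k
    rewrite beyond X (ℕₚ.m⊔n≤o⇒m≤o (bound X) _ b≤k)
          | beyond Y (ℕₚ.m⊔n≤o⇒m≤o (bound Y) _ (ℕₚ.m⊔n≤o⇒n≤o (bound X) _ b≤k))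
          | beyond Z (ℕₚ.m⊔n≤o⇒n≤o (bound Y) _ (ℕₚ.m⊔n≤o⇒n≤o (bound X) _ b≤k))
          = f≡false

∅ : FinSet
∅ = record { has = λ _ → false ; bound = 0 ; beyond = λ _ → ≡.refl }

_∪_ _∩_ _∖_ : FinSet → FinSet → FinSet
X ∪ Y = combine (λ x y _ → x ∨ y) ≡.refl X Y ∅
X ∩ Y = combine (λ x y _ → x ∧ y) ≡.refl X Y ∅
X ∖ Y = combine (λ x y _ → x ∧ not y) ≡.refl X Y ∅

⁅_⁆ : ℕ → FinSet
⁅ n ⁆ = record
  { has    = n ℕ.≡ᵇ_
  ; bound  = suc n
  ; beyond = λ {k} n<k → outside k n<k
  }
  where
  outside : ∀ k → n ℕ.< k → (n ℕ.≡ᵇ k) ≡ false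
  outside k n<k with n ℕ.≡ᵇ k in eq
  ... | false = ≡.refl
  ... | true  = contradiction (ℕₚ.≡ᵇ⇒≡ n k (≡.subst T (≡.sym eq) _)) (ℕₚ.<⇒≢ n<k)

∋⁅⁆⇒≡ : ∀ {n k} → ⁅ n ⁆ ∋ k → n ≡ k
∋⁅⁆⇒≡ {n} {k} = ℕₚ.≡ᵇ⇒≡ n k

widen : ℕ → FinSet → FinSet
widen n X = record
  { has    = has X
  ; bound  = bound X ℕ.⊔ n
  ; beyond = beyond X ∘ ℕₚ.m⊔n≤o⇒m≤o (bound X) n
  }

∪⁻ : ∀ X Y {k} → X ∪ Y ∋ k → X ∋ k ⊎ Y ∋ k
∪⁻ X Y {k} h with has X k
... | true  = inj₁ _
... | false = inj₂ h

∪⁺ˡ : ∀ X Y {k} → X ∋ k → X ∪ Y ∋ k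
∪⁺ˡ X Y {k} h with has X k
... | true = _

∪⁺ʳ : ∀ X Y {k} → Y ∋ k → X ∪ Y ∋ k
∪⁺ʳ X Y {k} h with has X k | has Y k
... | true  | _    = _
... | false | true = _

∪-⊑ : ∀ {X Y A} → X ⊑ A → Y ⊑ A → X ∪ Y ⊑ A
∪-⊑ {X} {Y} X⊑A Y⊑A h with ∪⁻ X Y h
... | inj₁ k∈X = X⊑A k∈X
... | inj₂ k∈Y = Y⊑A k∈Y

∩⁻ : ∀ X Y {k} → X ∩ Y ∋ k → X ∋ k × Y ∋ k
∩⁻ X Y {k} h with has X k | has Y k
... | true | true = _

∩⁺ : ∀ X Y {k} → X ∋ k → Y ∋ k → X ∩ Y ∋ k
∩⁺ X Y {k} h h′ with has X k | has Y k
... | true | true = _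

∖⁻ : ∀ X Y {k} → X ∖ Y ∋ k → X ∋ k × ¬ Y ∋ k
∖⁻ X Y {k} h with has X k | has Y k
... | true | false = _ , id

∖⁺ : ∀ X Y {k} → X ∋ k → ¬ Y ∋ k → X ∖ Y ∋ k
∖⁺ X Y {k} h h′ with has X k | has Y k
... | true | false = _
... | true | true  = h′ _

# : Bool → ℕ
# false = 0
# true  = 1

infixl 6 _⊞_
-- Formal sums of sets: `balance` compares the two sides of an identity by their multiplicities.
data Multiset : Set where
  [_] : FinSet → Multiset
  _⊞_ : Multiset → Multiset → Multiset

size : Multiset → ℕ
size [ X ]   = bound X
size (s ⊞ t) = size s ℕ.⊔ size t

mult : Multiset → ℕ → ℕ
mult [ X ]   k = # (has X k)
mult (s ⊞ t) k = mult s k ℕ.+ mult t k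

-- Sums over finite sets of indices

-- Only the operations are parameters, so that the values of finite sets in a
-- group and in its quotients, which share these operations, are the same terms.
module Values {c} {C : Set c} (_+_ : C → C → C) (0# : C) (e : ℕ → C) where

  infixl 8 _·_
  _·_ : ℕ → C → C
  zero  · x = 0#
  suc n · x = x + (n · x)

  combination : (ℕ → ℕ) → ℕ → C
  combination f zero    = 0#
  combination f (suc n) = combination f n + (f n · e n)

  val : FinSet → C
  val X = combination (# ∘ has X) (bound X)

  total : Multiset → C
  total [ X ]   = val X
  total (s ⊞ t) = total s + total t

module Sums {c ℓ} (Q : AbelianGroup c ℓ) (e : ℕ → AbelianGroup.Carrier Q) where
  open AbelianGroup Q
    renaming (_∙_ to infixl 6 _+_; ε to 0#; _⁻¹ to infix 8 -_)
    public
  open GroupProperties group public using (∙-cancelˡ; ∙-cancelʳ)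
  open MonoidSolver commutativeMonoid public
    using (solve; _⊕_; _⊜_)
  open Values _+_ 0# e public

  ·-homo-+ : ∀ m n x → (m ℕ.+ n) · x ≈ m · x + n · x
  ·-homo-+ zero    n x = sym (identityˡ _)
  ·-homo-+ (suc m) n x = trans (∙-congˡ (·-homo-+ m n x)) (sym (assoc _ _ _))

  combination-+ : ∀ f g n →
    combination (λ k → f k ℕ.+ g k) n ≈ combination f n + combination g n
  combination-+ f g zero    = sym (identityˡ _)
  combination-+ f g (suc n) = trans
    (∙-cong (combination-+ f g n) (·-homo-+ (f n) (g n) (e n)))
    (solve 4 (λ a b x y → ((a ⊕ b) ⊕ (x ⊕ y)) ⊜ ((a ⊕ x) ⊕ (b ⊕ y))) refl _ _ _ _)

  combination-cong : ∀ {f g} n → (∀ {k} → k ℕ.< n → f k ≡ g k) →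
    combination f n ≈ combination g n
  combination-cong zero    f≡g = refl
  combination-cong (suc n) f≡g = ∙-cong
    (combination-cong n (f≡g ∘ ℕₚ.m<n⇒m<1+n))
    (reflexive (≡.cong (_· e n) (f≡g ℕₚ.≤-refl)))

  combination-zero : ∀ n → combination (λ _ → 0) n ≈ 0#
  combination-zero zero    = refl
  combination-zero (suc n) = trans (identityʳ _) (combination-zero n)

  combination-extend : ∀ {f m} → (∀ {k} → m ℕ.≤ k → f k ≡ 0) →
    ∀ {n} → m ℕ.≤ n → combination f m ≈ combination f n
  combination-extend {f} {m} f≡0 m≤n = go (ℕₚ.≤⇒≤′ m≤n)
    where
    go : ∀ {n} → m ℕ.≤′ n → combination f m ≈ combination f n
    go (ℕ.≤′-reflexive ≡.refl) = refl
    go (ℕ.≤′-step {n} m≤n) = trans (go m≤n) (trans (sym (identityʳ _))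
      (∙-congˡ (reflexive (≡.cong (_· e n) (≡.sym (f≡0 (ℕₚ.≤′⇒≤ m≤n)))))))

  total≈combination : ∀ s {n} → size s ℕ.≤ n → total s ≈ combination (mult s) n
  total≈combination [ X ]   s≤n = combination-extend (≡.cong # ∘ beyond X) s≤n
  total≈combination (s ⊞ t) {n} s≤n = trans
    (∙-cong (total≈combination s (ℕₚ.m⊔n≤o⇒m≤o (size s) (size t) s≤n))
            (total≈combination t (ℕₚ.m⊔n≤o⇒n≤o (size s) (size t) s≤n)))
    (sym (combination-+ (mult s) (mult t) n))

  -- Both totals extend to a common range, where their coefficients agree. Identities between values
  -- thus become case distinctions on Booleans.
  balance : ∀ s t → (∀ k → mult s k ≡ mult t k) → total s ≈ total t
  balance s t s≡t = trans (total≈combination s (ℕₚ.m≤m⊔n (size s) (size t)))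
    (trans (combination-cong (size s ℕ.⊔ size t) (λ {k} _ → s≡t k))
      (sym (total≈combination t (ℕₚ.m≤n⊔m (size s) (size t)))))

  val-∪ : ∀ X Y → Disjoint X Y → val (X ∪ Y) ≈ val X + val Y
  val-∪ X Y X∩Y=∅ = balance [ X ∪ Y ] ([ X ] ⊞ [ Y ]) λ k →
    pointwise (has X k) (has Y k) X∩Y=∅
    where
    pointwise : ∀ x y → (T x → T y → ⊥) → # (x ∨ y) ≡ # x ℕ.+ # y
    pointwise true  true  h = ⊥-elim (h _ _)
    pointwise true  false h = ≡.refl
    pointwise false y     h = ≡.refl

  val-∖ : ∀ X Y → (∀ {k} → Y ∋ k → X ∋ k) → val X ≈ val Y + val (X ∖ Y)
  val-∖ X Y Y⊆X = balance [ X ] ([ Y ] ⊞ [ X ∖ Y ]) λ k →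
    pointwise (has X k) (has Y k) Y⊆X
    where
    pointwise : ∀ x y → (T y → T x) → # x ≡ # y ℕ.+ # (x ∧ not y)
    pointwise true  true  h = ≡.refl
    pointwise true  false h = ≡.refl
    pointwise false true  h = ⊥-elim (h _)
    pointwise false false h = ≡.refl

  val-⁅⁆ : ∀ n → val ⁅ n ⁆ ≈ e n
  val-⁅⁆ n = begin
    combination (# ∘ has ⁅ n ⁆) n + # (n ℕ.≡ᵇ n) · e n
      ≈⟨ ∙-cong (combination-cong n below) (reflexive (≡.cong (λ b → # b · e n) at-n)) ⟩
    combination (λ _ → 0) n + (e n + 0#)
      ≈⟨ ∙-cong (combination-zero n) (identityʳ _) ⟩
    0# + e n
      ≈⟨ identityˡ _ ⟩
    e n ∎
    where
    open import Relation.Binary.Reasoning.Setoid setoid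
    at-n : (n ℕ.≡ᵇ n) ≡ true
    at-n = Equivalence.to T-≡ (ℕₚ.≡⇒≡ᵇ n n ≡.refl)
    below : ∀ {k} → k ℕ.< n → # (n ℕ.≡ᵇ k) ≡ 0
    below {k} k<n with n ℕ.≡ᵇ k in eq
    ... | false = ≡.refl
    ... | true  = contradiction
      (≡.sym (ℕₚ.≡ᵇ⇒≡ n k (≡.subst T (≡.sym eq) _))) (ℕₚ.<⇒≢ k<n)

  -- The assumption that forces density zero. Over the quotient by a finite subgroup K, `val X ≈ 0#`
  -- means that the sum lies in K.
  SchurFree : Pred ℕ 0ℓ → Set ℓ
  SchurFree A = ∀ X P → X ⊑ A → P ⊑ A → val X + val X ≈ val P → val X ≈ 0#

-- Zero-sum sets in the absence of x ≠ 0 with x, 2x ∈ 𝒫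

module NullSets {c ℓ} (Q : AbelianGroup c ℓ) (e : ℕ → AbelianGroup.Carrier Q)
  (A : Pred ℕ 0ℓ) (schur-free : Sums.SchurFree Q e A) where

  open Sums Q e

  Null : FinSet → Set ℓ
  Null X = X ⊑ A × val X ≈ 0#

  -- The points where 1_Y + 1_W - 1_W′ takes the values 1, 2 and -1.
  ones twos negs : FinSet → FinSet → FinSet → FinSet
  ones = combine (λ y w w′ → (y xor w) ∧ not w′ ∨ y ∧ w ∧ w′) ≡.refl
  twos = combine (λ y w w′ → y ∧ w ∧ not w′) ≡.refl
  negs = combine (λ y w w′ → not y ∧ not w ∧ w′) ≡.refl

  ones⊑ : ∀ Y W W′ {k} → ones Y W W′ ∋ k → Y ∋ k ⊎ W ∋ k
  ones⊑ Y W W′ {k} h with has Y k | has W k | has W′ k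
  ... | true  | _     | _     = inj₁ _
  ... | false | true  | _     = inj₂ _

  twos⊑ : ∀ Y W W′ {k} → twos Y W W′ ∋ k → W ∋ k
  twos⊑ Y W W′ {k} h with has Y k | has W k
  ... | true  | true = _

  negs⊑ : ∀ Y W W′ {k} → negs Y W W′ ∋ k → W′ ∋ k
  negs⊑ Y W W′ {k} h with has Y k | has W k | has W′ k
  ... | false | false | true = _

  -- 1_Y + 1_W - 1_W′ = 2·1_X - 1_P for X = ones ∪ twos and P = ones ∪ negs,
  -- so x = ones + twos and p = ones + negs vanish; as twos and negs are
  -- disjoint with equal sums, twos vanishes as well.
  levels-null : ∀ {Y W W′} → Y ⊑ A → W ⊑ A → W′ ⊑ A →
    val Y + val W ≈ val W′ → Null (ones Y W W′) × Null (twos Y W W′)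
  levels-null {Y} {W} {W′} Y⊑A W⊑A W′⊑A y+w≈w′ = (V₁⊑A , v₁≈0) , (V₂⊑A , v₂≈0)
    where
    V₁ V₂ V₃ X P : FinSet
    V₁ = ones Y W W′
    V₂ = twos Y W W′
    V₃ = negs Y W W′
    X = V₁ ∪ V₂
    P = V₁ ∪ V₃

    V₁⊑A : V₁ ⊑ A
    V₁⊑A h with ones⊑ Y W W′ h
    ... | inj₁ k∈Y = Y⊑A k∈Y
    ... | inj₂ k∈W = W⊑A k∈W

    V₂⊑A : V₂ ⊑ A
    V₂⊑A = W⊑A ∘ twos⊑ Y W W′

    V₃⊑A : V₃ ⊑ A
    V₃⊑A = W′⊑A ∘ negs⊑ Y W W′

    V₁∩V₂=∅ : Disjoint V₁ V₂
    V₁∩V₂=∅ {k} h₁ h₂ with has Y k | has W k | has W′ k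
    ... | true | true | true  = h₂
    ... | true | true | false = h₁

    V₁∩V₃=∅ : Disjoint V₁ V₃
    V₁∩V₃=∅ {k} h₁ h₂ with has Y k | has W k | has W′ k
    ... | false | false | true = h₁

    V₂∩V₃=∅ : Disjoint V₂ V₃
    V₂∩V₃=∅ {k} h₁ h₂ with has Y k
    ... | true = h₂

    pointwise : ∀ y w w′ →
      # (((y xor w) ∧ not w′ ∨ y ∧ w ∧ w′) ∨ y ∧ w ∧ not w′)
        ℕ.+ # (((y xor w) ∧ not w′ ∨ y ∧ w ∧ w′) ∨ y ∧ w ∧ not w′)
        ℕ.+ # w′
      ≡ # (((y xor w) ∧ not w′ ∨ y ∧ w ∧ w′) ∨ not y ∧ not w ∧ w′)
        ℕ.+ (# y ℕ.+ # w)
    pointwise true  true  true  = ≡.refl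
    pointwise true  true  false = ≡.refl
    pointwise true  false true  = ≡.refl
    pointwise true  false false = ≡.refl
    pointwise false true  true  = ≡.refl
    pointwise false true  false = ≡.refl
    pointwise false false true  = ≡.refl
    pointwise false false false = ≡.refl

    2x≈p : val X + val X ≈ val P
    -- Adding w′ to both sides avoids subtraction: 2·1_X + 1_W′ = 1_P + 1_Y + 1_W holds pointwise,
    -- and y + w is then replaced by w′.
    2x≈p = ∙-cancelʳ (val W′) _ _ (trans
      (balance ([ X ] ⊞ [ X ] ⊞ [ W′ ]) ([ P ] ⊞ ([ Y ] ⊞ [ W ]))
        (λ k → pointwise (has Y k) (has W k) (has W′ k)))
      (∙-congˡ y+w≈w′))

    x≈0 : val X ≈ 0#
    x≈0 = schur-free X P (∪-⊑ {V₁} {V₂} V₁⊑A V₂⊑A) (∪-⊑ {V₁} {V₃} V₁⊑A V₃⊑A) 2x≈p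

    v₂≈v₃ : val V₂ ≈ val V₃
    v₂≈v₃ = ∙-cancelˡ (val V₁) _ _ (begin
      val V₁ + val V₂ ≈⟨ val-∪ V₁ V₂ V₁∩V₂=∅ ⟨
      val X           ≈⟨ x≈0 ⟩
      0#              ≈⟨ identityʳ 0# ⟨
      0# + 0#         ≈⟨ ∙-cong x≈0 x≈0 ⟨
      val X + val X   ≈⟨ 2x≈p ⟩
      val P           ≈⟨ val-∪ V₁ V₃ V₁∩V₃=∅ ⟩
      val V₁ + val V₃ ∎)
      where open import Relation.Binary.Reasoning.Setoid setoid

    v₂≈0 : val V₂ ≈ 0#
    v₂≈0 = schur-free V₂ (V₂ ∪ V₃) V₂⊑A (∪-⊑ {V₂} {V₃} V₂⊑A V₃⊑A)
      (trans (∙-congˡ v₂≈v₃) (sym (val-∪ V₂ V₃ V₂∩V₃=∅)))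

    v₁≈0 : val V₁ ≈ 0#
    v₁≈0 = ∙-cancelʳ (val V₂) _ _ (trans (sym (val-∪ V₁ V₂ V₁∩V₂=∅))
      (trans x≈0 (sym (trans (identityˡ _) v₂≈0))))

  -- Apply `levels-null` to x + 0 = z: the level set of value 1 is the difference.
  null-∖ : ∀ {X Z} → Null X → Null Z → Null (X ∖ Z)
  null-∖ {X} {Z} (X⊑A , x≈0) (Z⊑A , z≈0) =
    X⊑A ∘ proj₁ ∘ ∖⁻ X Z ,
    trans (balance [ X ∖ Z ] [ ones X ∅ Z ] λ k → pointwise (has X k) (has Z k))
      (proj₂ (proj₁ (levels-null {X} {∅} {Z} X⊑A (λ ()) Z⊑A
        (trans (identityʳ _) (trans x≈0 (sym z≈0))))))
    where
    pointwise : ∀ x z → # (x ∧ not z) ≡ # ((x xor false) ∧ not z ∨ x ∧ false ∧ z)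
    pointwise true  true  = ≡.refl
    pointwise true  false = ≡.refl
    pointwise false _     = ≡.refl

  null-∩ : ∀ {X Z} → Null X → Null Z → Null (X ∩ Z)
  null-∩ {X} {Z} X-null Z-null =
    proj₁ X-null ∘ proj₁ ∘ ∩⁻ X Z ,
    trans (balance [ X ∩ Z ] [ X ∖ (X ∖ Z) ] λ k → pointwise (has X k) (has Z k))
      (proj₂ (null-∖ {X} {X ∖ Z} X-null (null-∖ {X} {Z} X-null Z-null)))
    where
    pointwise : ∀ x z → # (x ∧ z) ≡ # (x ∧ not (x ∧ not z))
    pointwise true  true  = ≡.refl
    pointwise true  false = ≡.refl
    pointwise false _     = ≡.refl

  null-∪ : ∀ {X Z} → Null X → Null Z → Null (X ∪ Z)
  null-∪ {X} {Z} X-null Z-null =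
    ∪-⊑ {X} {Z} (proj₁ X-null) (proj₁ Z-null) ,
    trans (balance [ X ∪ Z ] ([ X ∖ Z ] ⊞ [ Z ]) λ k → pointwise (has X k) (has Z k))
      (trans (∙-cong (proj₂ (null-∖ {X} {Z} X-null Z-null)) (proj₂ Z-null)) (identityʳ _))
    where
    pointwise : ∀ x z → # (x ∨ z) ≡ # (x ∧ not z) ℕ.+ # z
    pointwise true  true  = ≡.refl
    pointwise true  false = ≡.refl
    pointwise false _     = ≡.refl

  null-widen : ∀ n {X} → Null X → Null (widen n X)
  null-widen n {X} (X⊑A , x≈0) =
    X⊑A , trans (balance [ widen n X ] [ X ] λ _ → ≡.refl) x≈0

  -- With `Y ∪ W` in place of W, and W′ disjoint from Y, the level set of value 2 is exactly Y.
  doubled-null : ∀ {Y W W′} → Y ⊑ A → W ⊑ A → W′ ⊑ A → Disjoint Y W → Disjoint Y W′ →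
    val Y + (val Y + val W) ≈ val W′ → val Y ≈ 0#
  doubled-null {Y} {W} {W′} Y⊑A W⊑A W′⊑A Y∩W=∅ Y∩W′=∅ 2y+w≈w′ =
    trans (balance [ Y ] [ twos Y (Y ∪ W) W′ ] λ k →
        pointwise (has Y k) (has W k) (has W′ k) Y∩W′=∅)
      (proj₂ (proj₂ (levels-null {Y} {Y ∪ W} {W′} Y⊑A (∪-⊑ {Y} {W} Y⊑A W⊑A) W′⊑A
        (trans (∙-congˡ (val-∪ Y W Y∩W=∅)) 2y+w≈w′))))
    where
    pointwise : ∀ y w w′ → (T y → T w′ → ⊥) → # y ≡ # (y ∧ (y ∨ w) ∧ not w′)
    pointwise true  w true  h = ⊥-elim (h _ _)
    pointwise true  w false h = ≡.refl
    pointwise false w w′    h = ≡.refl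

  -- Blocks of a sequence whose points can be isolated by zero-sum sets

  record Isolated (z : ℕ → ℕ) (U : FinSet) (t : ℕ) : Set ℓ where
    field
      set    : FinSet
      null   : Null set
      within : ∀ {k} → set ∋ k → U ∋ k
      point  : set ∋ z t
      only   : ∀ {s} → set ∋ z s → s ≡ t

  module Segments (z : ℕ → ℕ) (z-increasing : ∀ {s t} → s ℕ.< t → z s ℕ.< z t)
    (z∈A : ∀ t → A (z t)) (z≉0 : ∀ t → ¬ e (z t) ≈ 0#)
    (isolate : ∀ U t → Null U → U ∋ z t → Isolated z U t) where

    segment : ℕ → ℕ → FinSet
    segment a zero    = ∅
    segment a (suc m) = segment a m ∪ ⁅ z (a ℕ.+ m) ⁆

    segment⁻ : ∀ a m {k} → segment a m ∋ k →
      ∃ λ t → a ℕ.≤ t × t ℕ.< a ℕ.+ m × z t ≡ k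
    segment⁻ a (suc m) h with ∪⁻ (segment a m) ⁅ z (a ℕ.+ m) ⁆ h
    ... | inj₁ h′ = let t , a≤t , t<a+m , eq = segment⁻ a m h′ in
      t , a≤t , ℕₚ.<-≤-trans t<a+m (ℕₚ.+-monoʳ-≤ a (ℕₚ.n≤1+n m)) , eq
    ... | inj₂ h′ = a ℕ.+ m , ℕₚ.m≤m+n a m ,
      ℕₚ.+-monoʳ-< a (ℕₚ.n<1+n m) , ∋⁅⁆⇒≡ h′

    segment⁺ : ∀ a m {t} → a ℕ.≤ t → t ℕ.< a ℕ.+ m → segment a m ∋ z t
    segment⁺ a zero    {t} a≤t t<a+0 =
      contradiction a≤t (ℕₚ.<⇒≱ (≡.subst (t ℕ.<_) (ℕₚ.+-identityʳ a) t<a+0))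
    segment⁺ a (suc m) {t} a≤t t<a+1+m
      with ℕₚ.m≤n⇒m<n∨m≡n (ℕ.s≤s⁻¹ (≡.subst (t ℕ.<_) (ℕₚ.+-suc a m) t<a+1+m))
    ... | inj₁ t<a+m = ∪⁺ˡ (segment a m) ⁅ z (a ℕ.+ m) ⁆ (segment⁺ a m a≤t t<a+m)
    ... | inj₂ ≡.refl = ∪⁺ʳ (segment a m) ⁅ z (a ℕ.+ m) ⁆ (ℕₚ.≡⇒≡ᵇ (z t) (z t) ≡.refl)

    segment⊑A : ∀ a m → segment a m ⊑ A
    segment⊑A a m h with segment⁻ a m h
    ... | t , _ , _ , ≡.refl = z∈A t

    -- Differences of these partial sums are values of segments, so `σ` and its double provide the
    -- translates for the packing arguments.
    σ : ℕ → Carrier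
    σ zero    = 0#
    σ (suc t) = σ t + e (z t)

    σ-segment : ∀ a m → σ (a ℕ.+ m) ≈ σ a + val (segment a m)
    σ-segment a zero    =
      trans (reflexive (≡.cong σ (ℕₚ.+-identityʳ a))) (sym (identityʳ _))
    σ-segment a (suc m) = begin
      σ (a ℕ.+ suc m)                              ≡⟨ ≡.cong σ (ℕₚ.+-suc a m) ⟩
      σ (a ℕ.+ m) + e (z (a ℕ.+ m))                ≈⟨ ∙-cong (σ-segment a m) (sym (val-⁅⁆ _)) ⟩
      σ a + val (segment a m) + val ⁅ z (a ℕ.+ m) ⁆ ≈⟨ assoc _ _ _ ⟩
      σ a + (val (segment a m) + val ⁅ z (a ℕ.+ m) ⁆)
        ≈⟨ ∙-congˡ (val-∪ (segment a m) ⁅ z (a ℕ.+ m) ⁆ disjoint) ⟨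
      σ a + val (segment a (suc m)) ∎
      where
      open import Relation.Binary.Reasoning.Setoid setoid
      disjoint : Disjoint (segment a m) ⁅ z (a ℕ.+ m) ⁆
      disjoint h h′ with segment⁻ a m h
      ... | t , _ , t<a+m , ≡.refl =
        ℕₚ.<⇒≢ (z-increasing t<a+m) (≡.sym (∋⁅⁆⇒≡ h′))

    -- Isolating the first point of a zero-sum segment would leave the zero-sum set {z a}, against
    -- `z≉0`.
    segment≉0 : ∀ a m → ¬ val (segment a (suc m)) ≈ 0#
    segment≉0 a m seg≈0 with isolate (segment a (suc m)) a
      (segment⊑A a (suc m) , seg≈0)
      (segment⁺ a (suc m) ℕₚ.≤-refl (ℕₚ.m<m+n a (s≤s z≤n)))
    ... | record { set = V ; null = _ , v≈0 ; within = V⊆seg ; point = za∈V ; only = only } =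
      z≉0 a (trans (sym (val-⁅⁆ (z a))) (trans (balance [ ⁅ z a ⁆ ] [ V ] pointwise) v≈0))
      where
      pointwise : ∀ k → # (z a ℕ.≡ᵇ k) ≡ # (has V k)
      pointwise k with z a ℕ.≡ᵇ k in eq | has V k in eq′
      ... | true  | true  = ≡.refl
      ... | false | false = ≡.refl
      ... | true  | false with ≡.refl ← ℕₚ.≡ᵇ⇒≡ (z a) k (≡.subst T (≡.sym eq) _) =
        ⊥-elim (≡.subst T eq′ za∈V)
      ... | false | true with segment⁻ a (suc m) (V⊆seg (≡.subst T (≡.sym eq′) _))
      ...   | t , _ , _ , ≡.refl with ≡.refl ← only {t} (≡.subst T (≡.sym eq′) _) =
        ⊥-elim (≡.subst T eq (ℕₚ.≡⇒≡ᵇ (z t) (z t) ≡.refl))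

    -- A point of Y ∩ W lies in one of the null sets {v = 2} ⊆ W and
    -- {v = 1} ⊆ W ∪ Y; isolating it in the latter leaves a null subset of W.
    removable : ∀ {a m W W′ k} (let Y = segment a m) → W ⊑ A → W′ ⊑ A →
      val Y + val W ≈ val W′ → Y ∋ k → W ∋ k →
      ∃ λ R → Null R × R ∋ k × (∀ {j} → R ∋ j → W ∋ j)
    removable {a} {m} {W} {W′} W⊑A W′⊑A y+w≈w′ k∈Y k∈W with segment⁻ a m k∈Y
    ... | t , _ , _ , ≡.refl with has W′ (z t) in eq
    ...   | false = twos Y W W′ , proj₂ nulls , k∈twos , twos⊑ Y W W′
      where
      Y : FinSet
      Y = segment a m
      nulls : Null (ones Y W W′) × Null (twos Y W W′)
      nulls = levels-null {Y} {W} {W′} (segment⊑A a m) W⊑A W′⊑A y+w≈w′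
      k∈twos : twos Y W W′ ∋ z t
      k∈twos with has Y (z t) | has W (z t) | has W′ (z t)
      k∈twos | true | true | false = _
    ...   | true with isolate (ones (segment a m) W W′) t
            (proj₁ (levels-null {segment a m} {W} {W′} (segment⊑A a m) W⊑A W′⊑A y+w≈w′)) k∈ones
      where
      k∈ones : ones (segment a m) W W′ ∋ z t
      k∈ones with has (segment a m) (z t) | has W (z t) | has W′ (z t)
      k∈ones | true | true | true = _
    ...     | record { set = R ; null = R-null ; within = R⊆ones ; point = k∈R ; only = only } =
      R , R-null , k∈R , R⊆W
      where
      R⊆W : ∀ {j} → R ∋ j → W ∋ j
      R⊆W j∈R with ones⊑ (segment a m) W W′ (R⊆ones j∈R)
      ... | inj₂ j∈W = j∈W
      ... | inj₁ j∈Y with segment⁻ a m j∈Y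
      ...   | s , _ , _ , ≡.refl with ≡.refl ← only {s} j∈R = k∈W

    -- Go through the indices below `bound Y`. A point common to Y and the current set is removed
    -- together with a null subset containing it; this changes no value, so the equation persists,
    -- and it adds no points, so earlier indices stay avoided.
    avoiding : ∀ {a m W W′} (let Y = segment a m) → W ⊑ A → W′ ⊑ A →
      val Y + val W ≈ val W′ →
      ∃ λ V → V ⊑ A × Disjoint Y V × val W ≈ val V
    avoiding {a} {m} {W} {W′} W⊑A W′⊑A y+w≈w′ =
      let V , V⊑A , w≈v , avoids = go (bound Y) in
      V , V⊑A , (λ k∈Y → avoids (∋⇒< Y k∈Y) k∈Y) , w≈v
      where
      Y : FinSet
      Y = segment a m

      go : ∀ n → ∃ λ V → V ⊑ A × val W ≈ val V × (∀ {k} → k ℕ.< n → Y ∋ k → ¬ V ∋ k)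
      go zero    = W , W⊑A , refl , λ ()
      go (suc n) with go n
      ... | V , V⊑A , w≈v , avoids with T? (has Y n ∧ has V n)
      ...   | no n∉ = V , V⊑A , w≈v , λ {k} k<1+n k∈Y k∈V → case k k<1+n k∈Y k∈V
        where
        case : ∀ k → k ℕ.< suc n → Y ∋ k → V ∋ k → ⊥
        case k k<1+n k∈Y k∈V with ℕₚ.m<1+n⇒m<n∨m≡n k<1+n
        ... | inj₁ k<n = avoids k<n k∈Y k∈V
        ... | inj₂ ≡.refl = n∉ (∩⁺ Y V k∈Y k∈V)
      ...   | yes n∈ with removable {a} {m} {V} {W′} V⊑A W′⊑A
              (trans (∙-congˡ (sym w≈v)) y+w≈w′) (proj₁ (∩⁻ Y V n∈)) (proj₂ (∩⁻ Y V n∈))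
      ...     | R , (_ , r≈0) , n∈R , R⊆V =
        V ∖ R , V⊑A ∘ proj₁ ∘ ∖⁻ V R ,
        trans w≈v (trans (val-∖ V R R⊆V) (trans (∙-congʳ r≈0) (identityˡ _))) ,
        λ {k} → case k
        where
        case : ∀ k → k ℕ.< suc n → Y ∋ k → ¬ V ∖ R ∋ k
        case k k<1+n k∈Y h with ∖⁻ V R h | ℕₚ.m<1+n⇒m<n∨m≡n k<1+n
        ... | k∈V , _   | inj₁ k<n = avoids k<n k∈Y k∈V
        ... | _   , k∉R | inj₂ ≡.refl = k∉R n∈R

    σ-collision : ∀ a m {W W′} → W ⊑ A → W′ ⊑ A → σ (a ℕ.+ m) + val W ≈ σ a + val W′ →
      ∃ λ V → V ⊑ A × Disjoint (segment a m) V × val W ≈ val V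
    σ-collision a m {W} {W′} W⊑A W′⊑A eq = avoiding {a} {m} {W} {W′} W⊑A W′⊑A
      (∙-cancelˡ (σ a) _ _ (trans (sym (assoc _ _ _)) (trans (∙-congʳ (sym (σ-segment a m))) eq)))

    -- Cancelling `σ a + σ a` leaves 2y + w = w′, so y = 0 by `doubled-null`, against `segment≉0`.
    -- The length `suc m` keeps the segment nonempty.
    2σ-separated : ∀ a m {W W′} (let Y = segment a (suc m)) → W ⊑ A → W′ ⊑ A →
      Disjoint Y W → Disjoint Y W′ →
      ¬ (σ (a ℕ.+ suc m) + σ (a ℕ.+ suc m)) + val W ≈ (σ a + σ a) + val W′
    2σ-separated a m {W} {W′} W⊑A W′⊑A Y∩W=∅ Y∩W′=∅ eq = segment≉0 a m
      (doubled-null {Y} {W} {W′} (segment⊑A a (suc m)) W⊑A W′⊑A Y∩W=∅ Y∩W′=∅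
        (∙-cancelˡ (σ a + σ a) _ _ (begin
          (σ a + σ a) + (val Y + (val Y + val W))
            ≈⟨ solve 3 (λ s y w → ((s ⊕ s) ⊕ (y ⊕ (y ⊕ w))) ⊜ (((s ⊕ y) ⊕ (s ⊕ y)) ⊕ w))
                 refl (σ a) (val Y) (val W) ⟩
          ((σ a + val Y) + (σ a + val Y)) + val W
            ≈⟨ ∙-congʳ (∙-cong (σ-segment a (suc m)) (σ-segment a (suc m))) ⟨
          (σ (a ℕ.+ suc m) + σ (a ℕ.+ suc m)) + val W
            ≈⟨ eq ⟩
          (σ a + σ a) + val W′ ∎)))
      where
      open import Relation.Binary.Reasoning.Setoid setoid
      Y : FinSet
      Y = segment a (suc m)

  -- Choosing the sequence z₀, z₁, ...

  module Independent (dec : ∀ {P : Set ℓ} → Dec P)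
    (infinite : ∀ n → ∃ λ z → n ℕ.≤ z × A z × ¬ e z ≈ 0#) where

    -- The next point is taken beyond the zero-sum set D, which is then enlarged to
    -- contain that point if any zero-sum set does.
    record Step (D : FinSet) : Set ℓ where
      field
        point     : ℕ
        set       : FinSet
        bound≤    : bound D ℕ.≤ point
        <bound    : point ℕ.< bound set
        point∈A   : A point
        point≉0   : ¬ e point ≈ 0#
        null      : Null set
        extends   : ∀ {k} → D ∋ k → set ∋ k
        saturated : ∀ {U} → Null U → U ∋ point → set ∋ point

    step : ∀ D → Null D → Step D
    step D D-null with infinite (bound D)
    ... | z , D≤z , z∈A , z≉0 with dec {∃ λ U → Null U × U ∋ z}
    ...   | yes (U , U-null , z∈U) = record
      { point     = z
      ; set       = widen (suc z) (D ∪ U)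
      ; bound≤    = D≤z
      ; <bound    = ℕₚ.m≤n⊔m (bound (D ∪ U)) (suc z)
      ; point∈A   = z∈A
      ; point≉0   = z≉0
      ; null      = null-widen (suc z) {D ∪ U} (null-∪ {D} {U} D-null U-null)
      ; extends   = ∪⁺ˡ D U
      ; saturated = λ _ _ → ∪⁺ʳ D U z∈U
      }
    ...   | no ¬U = record
      { point     = z
      ; set       = widen (suc z) D
      ; bound≤    = D≤z
      ; <bound    = ℕₚ.m≤n⊔m (bound D) (suc z)
      ; point∈A   = z∈A
      ; point≉0   = z≉0
      ; null      = null-widen (suc z) {D} D-null
      ; extends   = id
      ; saturated = λ {U} U-null z∈U → contradiction (U , U-null , z∈U) ¬U
      }

    stage : ℕ → ∃ Null
    stage zero    = ∅ , (λ ()) , refl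
    stage (suc t) = let next = uncurry step (stage t) in Step.set next , Step.null next

    D : ℕ → FinSet
    D = proj₁ ∘ stage

    D-null : ∀ t → Null (D t)
    D-null = proj₂ ∘ stage

    module S t = Step (step (D t) (D-null t))

    z : ℕ → ℕ
    z = S.point

    D-monotone : ∀ {s t} → s ℕ.≤ t → ∀ {k} → D s ∋ k → D t ∋ k
    D-monotone {s} s≤t = go (ℕₚ.≤⇒≤′ s≤t)
      where
      go : ∀ {t} → s ℕ.≤′ t → ∀ {k} → D s ∋ k → D t ∋ k
      go (ℕ.≤′-reflexive ≡.refl) h = h
      go (ℕ.≤′-step {t} s≤t)     h = S.extends t (go s≤t h)

    bound-monotone : ∀ {s t} → s ℕ.≤ t → bound (D s) ℕ.≤ bound (D t)
    bound-monotone {s} s≤t = go (ℕₚ.≤⇒≤′ s≤t)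
      where
      go : ∀ {t} → s ℕ.≤′ t → bound (D s) ℕ.≤ bound (D t)
      go (ℕ.≤′-reflexive ≡.refl) = ℕₚ.≤-refl
      go (ℕ.≤′-step {t} s≤t) = ℕₚ.≤-trans (go s≤t)
        (ℕₚ.≤-trans (S.bound≤ t) (ℕₚ.<⇒≤ (S.<bound t)))

    z∉D : ∀ {s t} → s ℕ.≤ t → ¬ D s ∋ z t
    z∉D {s} {t} s≤t h = ℕₚ.<⇒≱ (∋⇒< (D s) h) (ℕₚ.≤-trans (bound-monotone s≤t) (S.bound≤ t))

    z-increasing : ∀ {s t} → s ℕ.< t → z s ℕ.< z t
    z-increasing {s} {t} s<t =
      ℕₚ.<-≤-trans (S.<bound s) (ℕₚ.≤-trans (bound-monotone s<t) (S.bound≤ t))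

    -- Cut U down to `D (suc t)` minus `D t`. Points z s with s > t lie beyond `D (suc t)`. If s < t
    -- and z s lies in U, then U itself witnesses, by saturation, that z s already belongs to `D t`.
    isolate : ∀ U t → Null U → U ∋ z t → Isolated z U t
    isolate U t U-null z∈U = record
      { set    = V
      ; null   = null-∖ {U ∩ D (suc t)} {D t}
          (null-∩ {U} {D (suc t)} U-null (D-null (suc t))) (D-null t)
      ; within = V⊆U
      ; point  = ∖⁺ (U ∩ D (suc t)) (D t)
          (∩⁺ U (D (suc t)) z∈U (S.saturated t {U} U-null z∈U)) (z∉D {t} {t} ℕₚ.≤-refl)
      ; only   = only
      }
      where
      V : FinSet
      V = (U ∩ D (suc t)) ∖ D t

      V⊆U : ∀ {k} → V ∋ k → U ∋ k
      V⊆U = proj₁ ∘ ∩⁻ U (D (suc t)) ∘ proj₁ ∘ ∖⁻ (U ∩ D (suc t)) (D t)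

      only : ∀ {s} → V ∋ z s → s ≡ t
      only {s} h with ℕₚ.<-cmp s t | ∖⁻ (U ∩ D (suc t)) (D t) h
      ... | tri≈ _ s≡t _ | _ = s≡t
      ... | tri> _ _ t<s | h′ , _ =
        contradiction (proj₂ (∩⁻ U (D (suc t)) h′)) (z∉D {suc t} {s} t<s)
      ... | tri< s<t _ _ | _ , z∉Dt =
        contradiction (D-monotone s<t (S.saturated s {U} U-null (V⊆U h))) z∉Dt

-- Density along the filtration

length-filter-⊎ : ∀ {a s t u} {X : Set a} {S : Pred X s} {T : Pred X t} {U : Pred X u}
  (S? : Decidable S) (T? : Decidable T) (U? : Decidable U) →
  (∀ {x} → S x → T x ⊎ U x) → ∀ xs →
  length (filter S? xs) ℕ.≤ length (filter T? xs) ℕ.+ length (filter U? xs)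
length-filter-⊎ S? T? U? S⊆T∪U [] = z≤n
length-filter-⊎ S? T? U? S⊆T∪U (x ∷ xs)
  with S? x | T? x | U? x | length-filter-⊎ S? T? U? S⊆T∪U xs
... | no _  | no _  | no _  | ih = ih
... | no _  | no _  | yes _ | ih = ℕₚ.≤-trans ih (ℕₚ.+-monoʳ-≤ _ (ℕₚ.n≤1+n _))
... | no _  | yes _ | no _  | ih = ℕₚ.m≤n⇒m≤1+n ih
... | no _  | yes _ | yes _ | ih =
  ℕₚ.m≤n⇒m≤1+n (ℕₚ.≤-trans ih (ℕₚ.+-monoʳ-≤ _ (ℕₚ.n≤1+n _)))
... | yes _ | yes _ | no _  | ih = s≤s ih
... | yes _ | yes _ | yes _ | ih = s≤s (ℕₚ.≤-trans ih (ℕₚ.+-monoʳ-≤ _ (ℕₚ.n≤1+n _)))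
... | yes _ | no _  | yes _ | ih = ℕₚ.≤-trans (s≤s ih) (ℕₚ.≤-reflexive (≡.sym (ℕₚ.+-suc _ _)))
... | yes s | no ¬t | no ¬u | ih with S⊆T∪U s
...   | inj₁ t = contradiction t ¬t
...   | inj₂ u = contradiction u ¬u

module Counting {c ℓ g} (G : AbelianGroup c ℓ) (G• : Additive.Filtration G g)
  (dec : ∀ {P : Set (c ⊔ ℓ)} → Dec P) where

  open Additive G
  open AbelianGroup G using (sym; trans)
  open GroupProperties (AbelianGroup.group G) using (∙-cancelˡ)
  open Filtration G•

  private
    to∈ : ∀ {i x} → Subgroup.member (term i) x → x ∈ elements i
    to∈ {i} {x} = Equivalence.to (Finite.complete (finite i) x)

    from∈ : ∀ {i x} → x ∈ elements i → Subgroup.member (term i) x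
    from∈ {i} {x} = Equivalence.from (Finite.complete (finite i) x)

  -- Membership in the list of elements lives at level `c ⊔ ℓ`, where `dec` applies, whatever the
  -- level of the filtration.
  finiteSubgroup : ℕ → Subgroup (c ⊔ ℓ)
  finiteSubgroup i = record
    { member     = _∈ elements i
    ; respects   = λ x≈y → to∈ ∘ Subgroup.respects (term i) x≈y ∘ from∈
    ; 0-closed   = to∈ (Subgroup.0-closed (term i))
    ; +-closed   = λ x∈ y∈ → to∈ (Subgroup.+-closed (term i) (from∈ x∈) (from∈ y∈))
    ; neg-closed = to∈ ∘ Subgroup.neg-closed (term i) ∘ from∈
    }

  ∈-ascending : ∀ {i j x} → i ℕ.≤ j → x ∈ elements i → x ∈ elements j
  ∈-ascending {i} {x = x} i≤j = go (ℕₚ.≤⇒≤′ i≤j)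
    where
    go : ∀ {j} → i ℕ.≤′ j → x ∈ elements i → x ∈ elements j
    go (ℕ.≤′-reflexive ≡.refl) x∈ = x∈
    go (ℕ.≤′-step i≤j)         x∈ = to∈ (ascending _ (from∈ (go i≤j x∈)))

  ∈-eventually : ∀ x → ∃ λ i → x ∈ elements i
  ∈-eventually x = let i , x∈ = exhaustive x in i , to∈ x∈

  all∈-eventually : ∀ {m} (f : Fin m → Carrier) →
    ∃ λ i₀ → ∀ {i} → i₀ ℕ.≤ i → ∀ a → f a ∈ elements i
  all∈-eventually {zero}  f = 0 , λ _ ()
  all∈-eventually {suc m} f =
    let i , f0∈ = ∈-eventually (f Fin.zero)
        j , f+∈ = all∈-eventually (f ∘ Fin.suc)
    in i ℕ.⊔ j , λ where
      i⊔j≤k Fin.zero    → ∈-ascending (ℕₚ.m⊔n≤o⇒m≤o i j i⊔j≤k) f0∈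
      i⊔j≤k (Fin.suc a) → f+∈ (ℕₚ.m⊔n≤o⇒n≤o i j i⊔j≤k) a

  lookup-injective : ∀ {xs} → Unique xs → ∀ {i j} → lookup xs i ≈ lookup xs j → i ≡ j
  lookup-injective (_  ∷ _)  {Fin.zero}  {Fin.zero}  eq = ≡.refl
  lookup-injective (x∉ ∷ _)  {Fin.zero}  {Fin.suc j} eq =
    contradiction eq (All.lookupₛ setoid (λ y≈z x≉y x≈z → x≉y (trans x≈z (sym y≈z))) x∉
      (Membershipₚ.∈-lookup setoid _ j))
  lookup-injective (x∉ ∷ _)  {Fin.suc i} {Fin.zero}  eq =
    contradiction (sym eq) (All.lookupₛ setoid (λ y≈z x≉y x≈z → x≉y (trans x≈z (sym y≈z))) x∉
      (Membershipₚ.∈-lookup setoid _ i))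
  lookup-injective (_  ∷ xs) {Fin.suc i} {Fin.suc j} eq =
    ≡.cong Fin.suc (lookup-injective xs eq)

  index≤ : ∀ {n xs} (f : Fin n → Carrier) → (∀ a → f a ∈ xs) →
    (∀ {a b} → f a ≈ f b → a ≡ b) → n ℕ.≤ length xs
  index≤ f f∈ f-injective = Finₚ.injective⇒≤ {f = Any.index ∘ f∈} λ {a} {b} eq →
    f-injective (Membershipₚ.index-injective setoid (f∈ a) (f∈ b) eq)

  count : ∀ {s} {S : Pred Carrier s} → Decidable S → ℕ → ℕ
  count S? i = length (filter S? (elements i))

  -- The pairs of a shift and an element of S ∩ G_i, coded as `Fin (m * k)`, map injectively into T
  -- ∩ G_i: different shifts give disjoint translates, and a single shift is cancellable.
  translates-count : ∀ {m s t} {S : Pred Carrier s} {T : Pred Carrier t}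
    (S? : Decidable S) (T? : Decidable T) → S Respects _≈_ → T Respects _≈_ →
    (f : Fin m → Carrier) → (∀ a {x} → S x → T (f a + x)) →
    (∀ {a b x y} → a Fin.< b → S x → S y → ¬ f a + x ≈ f b + y) →
    ∀ {i} → (∀ a → f a ∈ elements i) → m ℕ.* count S? i ℕ.≤ count T? i
  translates-count {m} {S = S} S? T? S-resp T-resp f S⇒T disjoint {i} f∈ =
    index≤ (uncurry shift ∘ Fin.remQuot k)
      (λ n → shift∈ (proj₁ (Fin.remQuot {m} k n)) (proj₂ (Fin.remQuot {m} k n)))
      λ {n} {n′} eq → ≡.trans (≡.sym (Finₚ.combine-remQuot {m} k n))
        (≡.trans (≡.cong (uncurry Fin.combine)
          (shift-injective {Fin.remQuot {m} k n} {Fin.remQuot {m} k n′} eq))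
          (Finₚ.combine-remQuot {m} k n′))
    where
    k : ℕ
    k = count S? i

    xs : List Carrier
    xs = filter S? (elements i)

    shift : Fin m → Fin k → Carrier
    shift a b = f a + lookup xs b

    xs∈ : ∀ b → lookup xs b ∈ elements i × S (lookup xs b)
    xs∈ b = Membershipₚ.∈-filter⁻ setoid S? S-resp (Membershipₚ.∈-lookup setoid xs b)

    shift∈ : ∀ a b → shift a b ∈ filter T? (elements i)
    shift∈ a b = let x∈ , Sx = xs∈ b in
      Membershipₚ.∈-filter⁺ setoid T? T-resp
        (Subgroup.+-closed (finiteSubgroup i) (f∈ a) x∈) (S⇒T a Sx)

    shift-injective : ∀ {p q} → uncurry shift p ≈ uncurry shift q → p ≡ q
    shift-injective {a , b} {a′ , b′} eq with Finₚ.<-cmp a a′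
    ... | tri< a<a′ _ _ = ⊥-elim (disjoint a<a′ (proj₂ (xs∈ b)) (proj₂ (xs∈ b′)) eq)
    ... | tri> _ _ a′<a = ⊥-elim (disjoint a′<a (proj₂ (xs∈ b′)) (proj₂ (xs∈ b)) (sym eq))
    ... | tri≈ _ ≡.refl _ = ≡.cong (a ,_)
      (lookup-injective (Uniqueₚ.filter⁺ setoid S? (Finite.unique (finite i)))
        (∙-cancelˡ (f a) _ _ eq))

  ∣_∣ : Pred Carrier (c ⊔ ℓ) → ℕ → ℕ
  ∣ S ∣ = count (λ x → dec {S x})

  -- Density at most 1/p, in the strong sense that the bound holds at all large
  -- levels of the filtration.
  Density≤1/ : ℕ → Pred Carrier (c ⊔ ℓ) → Set
  Density≤1/ p S = ∃ λ i₀ → ∀ {i} → i₀ ℕ.≤ i →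
    p ℕ.* ∣ S ∣ i ℕ.≤ order i

  Negligible : Pred Carrier (c ⊔ ℓ) → Set
  Negligible S = ∀ p → Density≤1/ p S

  -- Once G_i contains all m shifts, it contains m disjoint translates of S ∩ G_i.
  packing : ∀ {m} {S : Pred Carrier (c ⊔ ℓ)} → S Respects _≈_ → (f : Fin m → Carrier) →
    (∀ {a b x y} → a Fin.< b → S x → S y → ¬ f a + x ≈ f b + y) → Density≤1/ m S
  packing {S = S} S-resp f disjoint =
    let i₀ , f∈ = all∈-eventually f in
    i₀ , λ {i} i₀≤i → ℕₚ.≤-trans
      (translates-count (λ x → dec {S x}) (λ _ → yes tt) S-resp _ f _ disjoint (f∈ i₀≤i))
      (Listₚ.length-filter _ (elements i))

  density-∪ : ∀ {p} {S T U : Pred Carrier (c ⊔ ℓ)} → (∀ {x} → S x → T x ⊎ U x) →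
    Density≤1/ (2 ℕ.* p) T → Density≤1/ (2 ℕ.* p) U → Density≤1/ p S
  density-∪ {p} {S} {T} {U} S⊆T∪U (i , T≤) (j , U≤) = i ℕ.⊔ j , λ {k} i⊔j≤k →
    ℕₚ.*-cancelˡ-≤ 2 (begin
      2 ℕ.* (p ℕ.* ∣ S ∣ k)                             ≡⟨ ℕₚ.*-assoc 2 p _ ⟨
      2 ℕ.* p ℕ.* ∣ S ∣ k                               ≤⟨ ℕₚ.*-monoʳ-≤ (2 ℕ.* p)
        (length-filter-⊎ (λ x → dec {S x}) (λ x → dec {T x}) (λ x → dec {U x})
          S⊆T∪U (elements k)) ⟩
      2 ℕ.* p ℕ.* (∣ T ∣ k ℕ.+ ∣ U ∣ k)                 ≡⟨ ℕₚ.*-distribˡ-+ (2 ℕ.* p) _ _ ⟩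
      2 ℕ.* p ℕ.* ∣ T ∣ k ℕ.+ 2 ℕ.* p ℕ.* ∣ U ∣ k       ≤⟨ ℕₚ.+-mono-≤
        (T≤ (ℕₚ.m⊔n≤o⇒m≤o i j i⊔j≤k)) (U≤ (ℕₚ.m⊔n≤o⇒n≤o i j i⊔j≤k)) ⟩
      order k ℕ.+ order k                   ≡⟨ ≡.cong (order k ℕ.+_) (ℕₚ.+-identityʳ _) ⟨
      2 ℕ.* order k                         ∎)
    where open ℕₚ.≤-Reasoning

  ⋃ : ∀ {n} → (Fin n → Pred Carrier (c ⊔ ℓ)) → Pred Carrier (c ⊔ ℓ)
  ⋃ S x = ∃ λ k → S k x

  density-⋃ : ∀ {n p} .⦃ _ : ℕ.NonZero n ⦄ {S : Fin n → Pred Carrier (c ⊔ ℓ)} →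
    (∀ k → Density≤1/ (n ℕ.* p) (S k)) → Density≤1/ p (⋃ S)
  density-⋃ {n} {p} {S} S≤ = let i₀ , bound = go S S≤ in
    i₀ , λ {i} i₀≤i → ℕₚ.*-cancelˡ-≤ n
      (≡.subst (ℕ._≤ n ℕ.* order i) (ℕₚ.*-assoc n p (∣ ⋃ S ∣ i)) (bound i₀≤i))
    where
    -- The weight `n * p` stays fixed while the number `m` of sets varies; `n` is cancelled once at
    -- the end.
    go : ∀ {m} (S : Fin m → Pred Carrier (c ⊔ ℓ)) → (∀ k → Density≤1/ (n ℕ.* p) (S k)) →
      ∃ λ i₀ → ∀ {i} → i₀ ℕ.≤ i → n ℕ.* p ℕ.* ∣ ⋃ S ∣ i ℕ.≤ m ℕ.* order i
    go {zero} S S≤ = 0 , λ {i} _ → ℕₚ.≤-reflexive (≡.trans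
      (≡.cong (λ xs → n ℕ.* p ℕ.* length xs)
        (Listₚ.filter-none (λ x → dec {⋃ S x}) (All.universal (λ { _ (() , _) }) (elements i))))
      (ℕₚ.*-zeroʳ (n ℕ.* p)))
    go {suc m} S S≤ =
      let i , S₀≤ = S≤ Fin.zero
          j , S₊≤ = go (S ∘ Fin.suc) (S≤ ∘ Fin.suc)
          r = n ℕ.* p
      in i ℕ.⊔ j , λ {k} i⊔j≤k → begin
        r ℕ.* ∣ ⋃ S ∣ k
          ≤⟨ ℕₚ.*-monoʳ-≤ r (length-filter-⊎ (λ x → dec {⋃ S x}) (λ x → dec {S Fin.zero x})
               (λ x → dec {⋃ (S ∘ Fin.suc) x})
               (λ { (Fin.zero , s) → inj₁ s ; (Fin.suc k , s) → inj₂ (k , s) })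
               (elements k)) ⟩
        r ℕ.* (∣ S Fin.zero ∣ k ℕ.+ ∣ ⋃ (S ∘ Fin.suc) ∣ k)
          ≡⟨ ℕₚ.*-distribˡ-+ r _ _ ⟩
        r ℕ.* ∣ S Fin.zero ∣ k ℕ.+ r ℕ.* ∣ ⋃ (S ∘ Fin.suc) ∣ k
          ≤⟨ ℕₚ.+-mono-≤
               (S₀≤ (ℕₚ.m⊔n≤o⇒m≤o i j i⊔j≤k)) (S₊≤ (ℕₚ.m⊔n≤o⇒n≤o i j i⊔j≤k)) ⟩
        order k ℕ.+ m ℕ.* order k ∎
      where open ℕₚ.≤-Reasoning

  density-translate : ∀ {p} {S T : Pred Carrier (c ⊔ ℓ)} →
    S Respects _≈_ → T Respects _≈_ → ∀ y →
    (∀ {x} → S x → T (y + x)) → Density≤1/ p T → Density≤1/ p S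
  density-translate {p} {S} {T} S-resp T-resp y S⇒T (i , T≤) =
    let j , y∈ = ∈-eventually y in
    i ℕ.⊔ j , λ {k} i⊔j≤k → ℕₚ.≤-trans
      (ℕₚ.*-monoʳ-≤ p (≡.subst (ℕ._≤ ∣ T ∣ k) (ℕₚ.*-identityˡ (∣ S ∣ k))
        (translates-count {1} (λ x → dec {S x}) (λ x → dec {T x}) S-resp T-resp
          (λ _ → y) (λ _ → S⇒T)
          (λ { {Fin.zero} {Fin.zero} () })
          (λ _ → ∈-ascending (ℕₚ.m⊔n≤o⇒n≤o i j i⊔j≤k) y∈))))
      (T≤ (ℕₚ.m⊔n≤o⇒m≤o i j i⊔j≤k))

  -- S ∩ G_i never has more elements than G_j, whereas G_i eventually contains the first p·|G_j|
  -- values of the injection `e`.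
  finite⇒negligible : (e : ℕ → Carrier) → Injective _≡_ _≈_ e →
    ∀ {S : Pred Carrier (c ⊔ ℓ)} j → S Respects _≈_ → (∀ {x} → S x → x ∈ elements j) →
    Negligible S
  finite⇒negligible e e-injective {S} j S-resp S⊆ p =
    let i₀ , e∈ = all∈-eventually {p ℕ.* order j} (e ∘ Fin.toℕ) in
    i₀ , λ {i} i₀≤i → ℕₚ.≤-trans (ℕₚ.*-monoʳ-≤ p (∣S∣≤ i))
      (index≤ (e ∘ Fin.toℕ) (e∈ i₀≤i) (Finₚ.toℕ-injective ∘ e-injective))
    where
    ∣S∣≤ : ∀ i → ∣ S ∣ i ℕ.≤ order j
    ∣S∣≤ i = index≤ (lookup xs)
      (λ a → S⊆ (proj₂ (Membershipₚ.∈-filter⁻ setoid S? S-resp {xs = elements i}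
        (Membershipₚ.∈-lookup setoid xs a))))
      (lookup-injective (Uniqueₚ.filter⁺ setoid S? (Finite.unique (finite i))))
      where
      S? : Decidable S
      S? x = dec {S x}
      xs : List Carrier
      xs = filter S? (elements i)

-- Working modulo a finite subgroup

quotient : ∀ {c ℓ k} (G : AbelianGroup c ℓ) → Additive.Subgroup G k → AbelianGroup c (c ⊔ ℓ ⊔ k)
quotient {c} {ℓ} {k} G K = record
  { Carrier = Carrier
  ; _≈_     = _∼_
  ; _∙_     = _+_
  ; ε       = 0#
  ; _⁻¹     = -_
  ; isAbelianGroup = record
    { isGroup = record
      { isMonoid = record
        { isSemigroup = record
          { isMagma = record
            { isEquivalence = record
              { refl  = ≈⇒∼ refl
              ; sym   = ∼-sym
              ; trans = ∼-trans
              }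
            ; ∙-cong = ∼-cong
            }
          ; assoc = λ x y z → ≈⇒∼ (assoc x y z)
          }
        ; identity = (λ x → ≈⇒∼ (identityˡ x)) , (λ x → ≈⇒∼ (identityʳ x))
        }
      ; inverse = (λ x → ≈⇒∼ (inverseˡ x)) , (λ x → ≈⇒∼ (inverseʳ x))
      ; ⁻¹-cong = λ { {x} {y} (h , h∈K , x≈y+h) →
          - h , neg-closed h∈K , trans (⁻¹-cong x≈y+h) (sym (⁻¹-∙-comm y h)) }
      }
    ; comm = λ x y → ≈⇒∼ (comm x y)
    }
  }
  where
  open AbelianGroup G renaming (_∙_ to _+_; ε to 0#; _⁻¹ to -_)
  open AbelianGroupProperties G using (⁻¹-∙-comm)
  open Additive.Subgroup K
  open import Algebra.Solver.CommutativeMonoid commutativeMonoid using (solve; _⊕_; _⊜_)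

  _∼_ : Carrier → Carrier → Set (c ⊔ ℓ ⊔ k)
  x ∼ y = ∃ λ h → member h × x ≈ y + h

  ≈⇒∼ : ∀ {x y} → x ≈ y → x ∼ y
  ≈⇒∼ x≈y = 0# , 0-closed , trans x≈y (sym (identityʳ _))

  ∼-sym : ∀ {x y} → x ∼ y → y ∼ x
  ∼-sym {x} {y} (h , h∈K , x≈y+h) = - h , neg-closed h∈K , sym (trans (∙-congʳ x≈y+h)
    (trans (assoc y h (- h)) (trans (∙-congˡ (inverseʳ h)) (identityʳ y))))

  ∼-trans : ∀ {x y z} → x ∼ y → y ∼ z → x ∼ z
  ∼-trans {z = z} (h , h∈K , x≈y+h) (h′ , h′∈K , y≈z+h′) =
    h′ + h , +-closed h′∈K h∈K , trans x≈y+h (trans (∙-congʳ y≈z+h′) (assoc z h′ h))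

  ∼-cong : ∀ {x y u v} → x ∼ y → u ∼ v → (x + u) ∼ (y + v)
  ∼-cong {y = y} {v = v} (h , h∈K , x≈y+h) (h′ , h′∈K , u≈v+h′) =
    h + h′ , +-closed h∈K h′∈K , trans (∙-cong x≈y+h u≈v+h′)
      (solve 4 (λ a b c d → ((a ⊕ b) ⊕ (c ⊕ d)) ⊜ ((a ⊕ c) ⊕ (b ⊕ d))) refl y h v h′)

-- Subset sums up to an error in a finite subgroup

Tail : Pred ℕ 0ℓ → ℕ → Pred ℕ 0ℓ
Tail A n k = A k × n ℕ.≤ k

module Modulo {c ℓ g} (G : AbelianGroup c ℓ) (G• : Additive.Filtration G g)
  (dec : ∀ {P : Set (c ⊔ ℓ)} → Dec P) (e : ℕ → AbelianGroup.Carrier G)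
  (e-injective : Injective _≡_ (AbelianGroup._≈_ G) e) (i : ℕ) where

  open Additive G
  open Filtration G• using (elements)
  open Counting G G• dec

  Q : AbelianGroup c (c ⊔ ℓ)
  Q = quotient G (finiteSubgroup i)

  module Q = AbelianGroup Q
  private module G = AbelianGroup G
  open Sums Q e using (SchurFree; val; val-∖; val-⁅⁆; combination)

  ≈⇒∼ : ∀ {x y} → x ≈ y → x Q.≈ y
  ≈⇒∼ x≈y = 0# , Subgroup.0-closed (finiteSubgroup i) , G.trans x≈y (G.sym (G.identityʳ _))

  ∼0⇒∈ : ∀ {x} → x Q.≈ 0# → x ∈ elements i
  ∼0⇒∈ (h , h∈ , x≈0+h) =
    Subgroup.respects (finiteSubgroup i) (G.sym (G.trans x≈0+h (G.identityˡ h))) h∈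

  ∈⇒∼0 : ∀ {x} → x ∈ elements i → x Q.≈ 0#
  ∈⇒∼0 x∈ = _ , x∈ , G.sym (G.identityˡ _)

  -- This is 𝒫(A) + K, where K consists of `elements i` and indices stand for their values under
  -- `e`.
  Reach : Pred ℕ 0ℓ → Pred Carrier (c ⊔ ℓ)
  Reach A x = ∃ λ X → X ⊑ A × x Q.≈ val X

  Reach-resp : ∀ {A} → Reach A Respects _≈_
  Reach-resp x≈y (X , X⊑A , x∼X) = X , X⊑A , Q.trans (≈⇒∼ (G.sym x≈y)) x∼X

  Reach-mono : ∀ {A B} → (∀ {k} → A k → B k) → ∀ {x} → Reach A x → Reach B x
  Reach-mono A⊆B (X , X⊑A , x∼X) = X , A⊆B ∘ X⊑A , x∼X

  negligible-⊆ : ∀ {A B} → (∀ {k} → A k → B k) → Negligible (Reach B) → Negligible (Reach A)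
  negligible-⊆ {A} {B} A⊆B negl p = density-translate {p} Reach-resp Reach-resp 0#
    (λ r → Reach-resp (G.sym (G.identityˡ _)) (Reach-mono A⊆B r)) (negl p)

  -- Restoring the index n adds at most one translate, by `e n`, of the sums over the shorter tail.
  negligible-tail : ∀ A n → Negligible (Reach (Tail A n)) → Negligible (Reach A)
  negligible-tail A zero    = negligible-⊆ (_, z≤n)
  negligible-tail A (suc n) negl = negligible-tail A n λ p →
    density-∪ {p} {Reach (Tail A n)} {Reach (Tail A (suc n))} {U} split
      (negl (2 ℕ.* p))
      (density-translate {2 ℕ.* p} U-resp Reach-resp (- e n) id (negl (2 ℕ.* p)))
    where
    U : Pred Carrier (c ⊔ ℓ)
    U x = Reach (Tail A (suc n)) (- e n + x)

    U-resp : U Respects _≈_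
    U-resp x≈y = Reach-resp (G.∙-congˡ x≈y)

    split : ∀ {x} → Reach (Tail A n) x → Reach (Tail A (suc n)) x ⊎ U x
    split {x} (X , X⊑ , x∼X) with T? (has X n)
    ... | no n∉X = inj₁ (X , (λ {k} k∈X →
      proj₁ (X⊑ k∈X) , ℕₚ.≤∧≢⇒< (proj₂ (X⊑ k∈X)) λ { ≡.refl → n∉X k∈X }) , x∼X)
    ... | yes n∈X = inj₂ (X ∖ ⁅ n ⁆ ,
      (λ {k} h → let k∈X , k∉n = ∖⁻ X ⁅ n ⁆ h in
        proj₁ (X⊑ k∈X) , ℕₚ.≤∧≢⇒< (proj₂ (X⊑ k∈X)) λ { ≡.refl → k∉n (ℕₚ.≡⇒≡ᵇ n n ≡.refl) }) ,
      (begin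
        - e n + x                       ≈⟨ Q.∙-congˡ {x = - e n} (Q.trans x∼X
                                             (val-∖ X ⁅ n ⁆ λ h → ≡.subst (X ∋_) (∋⁅⁆⇒≡ h) n∈X)) ⟩
        - e n + (val ⁅ n ⁆ + val X′)    ≈⟨ Q.∙-congˡ {x = - e n}
                                             (Q.∙-congʳ {x = val X′} (val-⁅⁆ n)) ⟩
        - e n + (e n + val X′)          ≈⟨ Q.assoc (- e n) (e n) (val X′) ⟨
        - e n + e n + val X′            ≈⟨ Q.∙-congʳ {x = val X′} (Q.inverseˡ (e n)) ⟩
        0# + val X′                     ≈⟨ Q.identityˡ (val X′) ⟩
        val X′                          ∎))
      where
      open import Relation.Binary.Reasoning.Setoid Q.setoid
      X′ : FinSet
      X′ = X ∖ ⁅ n ⁆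

  module _ (A : Pred ℕ 0ℓ) (schur-free : SchurFree A) where

    open NullSets Q e A schur-free

    module _ (z : ℕ → ℕ) (z-increasing : ∀ {s t} → s ℕ.< t → z s ℕ.< z t)
      (z∈A : ∀ t → A (z t)) (z≉0 : ∀ t → ¬ e (z t) Q.≈ 0#)
      (isolate : ∀ U t → Null U → U ∋ z t → Isolated z U t) where

      open Segments z z-increasing z∈A z≉0 isolate

      Avoiding : ℕ → ℕ → Pred ℕ 0ℓ
      Avoiding a m k = A k × ¬ segment a m ∋ k

      -- The m translates by 2σ(a + t), t < m, are disjoint: two of these shifts differ by twice the
      -- value of a nonempty segment inside the avoided block.
      avoiding-density : ∀ a m → Density≤1/ m (Reach (Avoiding a m))
      avoiding-density a m = packing Reach-resp (λ t → σ (a ℕ.+ Fin.toℕ t) + σ (a ℕ.+ Fin.toℕ t))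
        λ {s} {t} s<t → disjoint (Finₚ.toℕ<n t) s<t
        where
        disjoint : ∀ {s t x y} → t ℕ.< m → s ℕ.< t →
          Reach (Avoiding a m) x → Reach (Avoiding a m) y →
          ¬ (σ (a ℕ.+ s) + σ (a ℕ.+ s)) + x ≈ (σ (a ℕ.+ t) + σ (a ℕ.+ t)) + y
        disjoint {s} {t} {x} {y} t<m s<t (W , W⊑ , x∼W) (W′ , W′⊑ , y∼W′) eq
          with ℕₚ.m≤n⇒∃[o]m+o≡n s<t
        -- The later partial sum must stand on the left, so W and W′ change places.
        ... | d , 1+s+d≡t = 2σ-separated (a ℕ.+ s) d {W′} {W}
          (proj₁ ∘ W′⊑) (proj₁ ∘ W⊑)
          (λ k∈Y k∈W′ → proj₂ (W′⊑ k∈W′) (⊆segment k∈Y))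
          (λ k∈Y k∈W → proj₂ (W⊑ k∈W) (⊆segment k∈Y))
          (≡.subst (λ r → (σ r + σ r) + val W′ Q.≈ (σ (a ℕ.+ s) + σ (a ℕ.+ s)) + val W)
            (≡.sym a+s+1+d≡a+t)
            (Q.trans (Q.∙-congˡ {x = σ (a ℕ.+ t) + σ (a ℕ.+ t)} (Q.sym y∼W′))
              (Q.trans (≈⇒∼ (G.sym eq)) (Q.∙-congˡ {x = σ (a ℕ.+ s) + σ (a ℕ.+ s)} x∼W))))
          where
          a+s+1+d≡a+t : a ℕ.+ s ℕ.+ suc d ≡ a ℕ.+ t
          a+s+1+d≡a+t = ≡.trans (ℕₚ.+-assoc a s (suc d))
            (≡.cong (a ℕ.+_) (≡.trans (ℕₚ.+-suc s d) 1+s+d≡t))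

          ⊆segment : ∀ {k} → segment (a ℕ.+ s) (suc d) ∋ k → segment a m ∋ k
          ⊆segment k∈ with segment⁻ (a ℕ.+ s) (suc d) k∈
          ... | u , a+s≤u , u< , ≡.refl = segment⁺ a m (ℕₚ.m+n≤o⇒m≤o a a+s≤u)
            (ℕₚ.<-≤-trans u< (ℕₚ.≤-trans (ℕₚ.≤-reflexive a+s+1+d≡a+t)
              (ℕₚ.+-monoʳ-≤ a (ℕₚ.<⇒≤ t<m))))

      segment-prefix : ∀ a m n {k} → segment a m ∋ k → segment a (m ℕ.+ n) ∋ k
      segment-prefix a m n k∈ with segment⁻ a m k∈
      ... | u , a≤u , u< , ≡.refl = segment⁺ a (m ℕ.+ n) a≤u
        (ℕₚ.<-≤-trans u< (ℕₚ.+-monoʳ-≤ a (ℕₚ.m≤m+n m n)))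

      -- The collision lets y avoid all m + n points from index a on, in particular the block formed
      -- by the first m.
      Reach-avoiding : ∀ a m n {x y} → Reach A x → Reach A y →
        σ (a ℕ.+ (m ℕ.+ n)) + y Q.≈ σ a + x → Reach (Avoiding a m) y
      Reach-avoiding a m n {x} {y} (W′ , W′⊑A , x∼W′) (W , W⊑A , y∼W) eq =
        let V , V⊑A , Y∩V=∅ , w∼v = σ-collision a (m ℕ.+ n) {W} {W′} W⊑A W′⊑A
              (Q.trans (Q.∙-congˡ {x = σ (a ℕ.+ (m ℕ.+ n))} (Q.sym y∼W))
                (Q.trans eq (Q.∙-congˡ {x = σ a} x∼W′)))
        in V , (λ k∈V → V⊑A k∈V , λ k∈ → Y∩V=∅ (segment-prefix a m n k∈) k∈V) ,
          Q.trans y∼W w∼v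

      module _ (q m : ℕ) where

        Missing : Fin q → Pred Carrier (c ⊔ ℓ)
        Missing k = Reach (Avoiding (Fin.toℕ k ℕ.* m) m)

        -- The sums each of whose representations meets every one of the q consecutive blocks of
        -- length m.
        Meeting : Pred Carrier (c ⊔ ℓ)
        Meeting x = Reach A x × ¬ ⋃ Missing x

        Meeting-resp : Meeting Respects _≈_
        Meeting-resp x≈y (r , ¬missing) =
          Reach-resp x≈y r , λ { (k , r′) → ¬missing (k , Reach-resp (G.sym x≈y) r′) }

        -- If the translates for blocks s < t collided, `Reach-avoiding` would represent y without
        -- block s.
        meeting-density : Density≤1/ q Meeting
        meeting-density = packing Meeting-resp (λ k → σ (Fin.toℕ k ℕ.* m)) disjoint
          where
          disjoint : ∀ {s t x y} → s Fin.< t → Meeting x → Meeting y →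
            ¬ σ (Fin.toℕ s ℕ.* m) + x ≈ σ (Fin.toℕ t ℕ.* m) + y
          disjoint {s} {t} {x} {y} s<t (x∈ , _) (y∈ , ¬missing) eq =
            ¬missing (s , Reach-avoiding (Fin.toℕ s ℕ.* m) m (d ℕ.* m) x∈ y∈
              (≈⇒∼ (≡.subst (λ r → σ r + y ≈ σ (Fin.toℕ s ℕ.* m) + x) t*m≡ (G.sym eq))))
            where
            d : ℕ
            d = proj₁ (ℕₚ.m≤n⇒∃[o]m+o≡n s<t)

            t*m≡ : Fin.toℕ t ℕ.* m ≡ Fin.toℕ s ℕ.* m ℕ.+ (m ℕ.+ d ℕ.* m)
            t*m≡ = ≡.trans (≡.cong (ℕ._* m) (≡.sym (≡.trans (ℕₚ.+-suc (Fin.toℕ s) d)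
                (proj₂ (ℕₚ.m≤n⇒∃[o]m+o≡n s<t)))))
              (ℕₚ.*-distribʳ-+ m (Fin.toℕ s) (suc d))

      negligible-of-sequence : Negligible (Reach A)
      negligible-of-sequence zero    = 0 , λ _ → z≤n
      negligible-of-sequence p@(suc _) =
        density-∪ {p} {Reach A} {Meeting q m} {⋃ (Missing q m)} split
          (meeting-density q m)
          (density-⋃ {q} {q} {Missing q m} λ k → avoiding-density (Fin.toℕ k ℕ.* m) m)
        where
        -- `Meeting` has density at most 1/q. Each of the q sets `Missing` has density at most 1/q²,
        -- hence their union at most 1/q; together this is 2/q = 1/p.
        q m : ℕ
        q = 2 ℕ.* p
        m = q ℕ.* q

        split : ∀ {x} → Reach A x → Meeting q m x ⊎ ⋃ (Missing q m) x
        split {x} r with dec {⋃ (Missing q m) x}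
        ... | yes missing = inj₂ missing
        ... | no ¬missing = inj₁ (r , ¬missing)

    -- Either A eventually lies in K, and then so do all sums over some tail, or infinitely many
    -- points outside K are available for the independent sequence.
    schur-free⇒negligible : Negligible (Reach A)
    schur-free⇒negligible with dec {∃ λ n → ∀ k → n ℕ.≤ k → A k → e k Q.≈ 0#}
    ... | yes (n , vanishes) = negligible-tail A n
      (finite⇒negligible e e-injective i Reach-resp λ { (X , X⊑ , x∼X) →
        ∼0⇒∈ (Q.trans x∼X (val-vanish X λ k∈X →
          let k∈A , n≤k = X⊑ k∈X in vanishes _ n≤k k∈A)) })
      where
      val-vanish : ∀ X → (∀ {k} → X ∋ k → e k Q.≈ 0#) → val X Q.≈ 0#
      val-vanish X X⇒0 = go (bound X)
        where
        go : ∀ n → combination (# ∘ has X) n Q.≈ 0#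
        go zero    = Q.refl
        go (suc n) with has X n in eq
        ... | false = Q.trans (Q.identityʳ (combination (# ∘ has X) n)) (go n)
        ... | true  = Q.trans (Q.∙-cong (go n) (Q.trans (Q.identityʳ (e n))
          (X⇒0 (≡.subst T (≡.sym eq) _)))) (Q.identityˡ 0#)
    ... | no ¬vanishes = negligible-of-sequence z z-increasing S.point∈A S.point≉0 isolate
      where
      infinite : ∀ n → ∃ λ k → n ℕ.≤ k × A k × ¬ e k Q.≈ 0#
      infinite n with dec {∃ λ k → n ℕ.≤ k × A k × ¬ e k Q.≈ 0#}
      ... | yes found = found
      ... | no ¬found = contradiction
        (n , λ k n≤k k∈A → decidable-stable dec λ ek≉0 → ¬found (k , n≤k , k∈A , ek≉0))
        ¬vanishes

      open Independent dec infinite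

-- Removing the error term

-- An entry failing at level m fails at all later levels, so the remaining entries must supply the
-- witnesses there; the list is exhausted unless some entry never fails.
recurrent : ∀ {c p} {C : Set c} → (∀ {P : Set p} → Dec P) → (Φ : ℕ → Pred C p) →
  (∀ {m n x} → m ℕ.≤ n → Φ n x → Φ m x) →
  ∀ xs → (∀ n → Any (Φ n) xs) → Any (λ x → ∀ n → Φ n x) xs
recurrent dec Φ antitone []       any = contradiction (any 0) λ ()
recurrent dec Φ antitone (x ∷ xs) any with dec {∃ λ n → ¬ Φ n x}
... | no ¬fails     = here λ n → decidable-stable dec λ ¬Φ → ¬fails (n , ¬Φ)
... | yes (m , ¬Φm) = there (recurrent dec Φ antitone xs λ n →
  Any.map (antitone (ℕₚ.m≤m⊔n n m)) (Any.tail (¬Φm ∘ antitone (ℕₚ.m≤n⊔m n m)) (any (n ℕ.⊔ m))))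

module Halvings {c ℓ} (G : AbelianGroup c ℓ)
  (e : ℕ → AbelianGroup.Carrier G) (A : Pred ℕ 0ℓ) where

  open Additive G
  open Sums G e hiding (Carrier; _≈_; setoid; _+_; 0#; -_)

  -- A witness x with 2x in 𝒫(A) up to an error κ; the tail index allows disjoint supports.
  record Halving (n : ℕ) (κ : Carrier) : Set ℓ where
    field
      half whole : FinSet
      half⊑      : half ⊑ Tail A n
      whole⊑     : whole ⊑ Tail A n
      equation   : val half + val half ≈ val whole + κ

    width : ℕ
    width = bound half ℕ.⊔ bound whole

  open Halving

  Unbounded : ∀ {g} → Filtration g → Set (c ⊔ ℓ)
  Unbounded G• =
    ∀ j n → ∃ λ (H : Halving n 0#) → ¬ val (half H) ∈ Filtration.elements G• j

  Halving-resp : ∀ {n} → Halving n Respects _≈_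
  Halving-resp κ≈κ′ H = record
    { half = half H ; whole = whole H ; half⊑ = half⊑ H ; whole⊑ = whole⊑ H
    ; equation = trans (equation H) (∙-congˡ κ≈κ′)
    }

  Halving-antitone : ∀ {m n κ} → m ℕ.≤ n → Halving n κ → Halving m κ
  Halving-antitone m≤n H = record
    { half     = half H
    ; whole    = whole H
    ; half⊑    = λ k∈ → let k∈A , n≤k = half⊑ H k∈ in k∈A , ℕₚ.≤-trans m≤n n≤k
    ; whole⊑   = λ k∈ → let k∈A , n≤k = whole⊑ H k∈ in k∈A , ℕₚ.≤-trans m≤n n≤k
    ; equation = equation H
    }

  empty : ∀ {n} → Halving n 0#
  empty = record { half = ∅ ; whole = ∅ ; half⊑ = λ () ; whole⊑ = λ () ; equation = refl }

  ∪-⊑-Tail : ∀ {n N X Y} → n ℕ.≤ N → X ⊑ Tail A n → Y ⊑ Tail A N → X ∪ Y ⊑ Tail A n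
  ∪-⊑-Tail {n} {N} {X} {Y} n≤N X⊑ Y⊑ = ∪-⊑ {X} {Y} {Tail A n} X⊑
    λ k∈Y → let k∈A , N≤k = Y⊑ k∈Y in k∈A , ℕₚ.≤-trans n≤N N≤k

  val-∪-Tail : ∀ {N X Y} → bound X ℕ.≤ N → Y ⊑ Tail A N → val (X ∪ Y) ≈ val X + val Y
  val-∪-Tail {N} {X} {Y} X≤N Y⊑ = val-∪ X Y λ k∈X k∈Y →
    ℕₚ.<⇒≱ (∋⇒< X k∈X) (ℕₚ.≤-trans X≤N (proj₂ (Y⊑ k∈Y)))

  module _ {n N κ κ′} (H : Halving n κ) (H′ : Halving N κ′)
    (n≤N : n ℕ.≤ N) (H≤N : width H ℕ.≤ N) where

    val-half-join : val (half H ∪ half H′) ≈ val (half H) + val (half H′)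
    val-half-join = val-∪-Tail {X = half H} {half H′}
      (ℕₚ.m⊔n≤o⇒m≤o (bound (half H)) _ H≤N) (half⊑ H′)

    -- H lies below N and H′ from N on, so the supports are disjoint and the errors add.
    join : Halving n (κ + κ′)
    join = record
      { half     = half H ∪ half H′
      ; whole    = whole H ∪ whole H′
      ; half⊑    = ∪-⊑-Tail {X = half H} {half H′} n≤N (half⊑ H) (half⊑ H′)
      ; whole⊑   = ∪-⊑-Tail {X = whole H} {whole H′} n≤N (whole⊑ H) (whole⊑ H′)
      ; equation = begin
          val (half H ∪ half H′) + val (half H ∪ half H′)
            ≈⟨ ∙-cong val-half-join val-half-join ⟩
          (x + x′) + (x + x′)
            ≈⟨ interchange x x′ x x′ ⟩
          (x + x) + (x′ + x′)
            ≈⟨ ∙-cong (equation H) (equation H′) ⟩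
          (val (whole H) + κ) + (val (whole H′) + κ′)
            ≈⟨ interchange (val (whole H)) κ (val (whole H′)) κ′ ⟩
          (val (whole H) + val (whole H′)) + (κ + κ′)
            ≈⟨ ∙-congʳ (val-∪-Tail {X = whole H} {whole H′}
                 (ℕₚ.m⊔n≤o⇒n≤o (bound (half H)) _ H≤N) (whole⊑ H′)) ⟨
          val (whole H ∪ whole H′) + (κ + κ′) ∎
      }
      where
      open import Relation.Binary.Reasoning.Setoid setoid
      open import Algebra.Properties.CommutativeSemigroup commutativeSemigroup using (interchange)
      x x′ : Carrier
      x = val (half H)
      x′ = val (half H′)

  -- The remaining copies are placed beyond the first, which is why κ must occur on every tail.
  copies : ∀ {κ} → (∀ n → Halving n κ) → ∀ m n → Halving n (m · κ)
  copies H zero    n = empty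
  copies H (suc m) n =
    let H₁ = H n in
    join H₁ (copies H m (n ℕ.⊔ width H₁)) (ℕₚ.m≤m⊔n n _) (ℕₚ.m≤n⊔m n _)

  -- The opposite error in R makes the halving exact, at the price of shifting the half by that of
  -- R.
  join-complement : ∀ {n N κ κ⁻} → κ⁻ + κ ≈ 0# → (R : Halving n κ⁻) (H : Halving N κ) →
    n ℕ.≤ N → width R ℕ.≤ N →
    ∃ λ (J : Halving n 0#) → val (half J) ≈ val (half R) + val (half H)
  join-complement κ⁻+κ≈0 R H n≤N R≤N =
    Halving-resp κ⁻+κ≈0 (join R H n≤N R≤N) , val-half-join R H n≤N R≤N

-- Exact halvings outside every G_j

module UnboundedHalvings {c ℓ g} (G : AbelianGroup c ℓ) (G• : Additive.Filtration G g)
  (dec : ∀ {P : Set (c ⊔ ℓ)} → Dec P) (e : ℕ → AbelianGroup.Carrier G)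
  (e-injective : Injective _≡_ (AbelianGroup._≈_ G) e) (A : Pred ℕ 0ℓ)
  (positive : ∀ i →
    ¬ Counting.Negligible G G• dec (Modulo.Reach G G• dec e e-injective i A)) where

  open Additive G
  open Counting G G• dec
  open Modulo G G• dec e e-injective
  open Filtration G• using (elements; order)
  open Sums G e hiding (Carrier; _≈_; setoid; _+_; 0#; -_)
  open AbelianGroupProperties G using (⁻¹-∙-comm)
  open Halvings G e A
  open Halving

  module K i = Subgroup (finiteSubgroup i)

  -- Two of the multiples n·κ with n at most `order i` coincide by the pigeonhole principle.
  torsion : ∀ {i κ} → κ ∈ elements i → ∃ λ m → suc m · κ ≈ 0#
  torsion {i} {κ} κ∈ =
    let a , b , a<b , eq = Finₚ.pigeonhole (ℕₚ.n<1+n (order i)) (Any.index ∘ multiple∈ ∘ Fin.toℕ)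
        m , 1+a+m≡b = ℕₚ.m≤n⇒∃[o]m+o≡n a<b
    in m , ∙-cancelˡ (Fin.toℕ a · κ) _ _ (begin
      Fin.toℕ a · κ + suc m · κ     ≈⟨ ·-homo-+ (Fin.toℕ a) (suc m) κ ⟨
      (Fin.toℕ a ℕ.+ suc m) · κ     ≡⟨ ≡.cong (_· κ) (≡.trans (ℕₚ.+-suc _ m) 1+a+m≡b) ⟩
      Fin.toℕ b · κ                 ≈⟨ Membershipₚ.index-injective setoid
                                         (multiple∈ (Fin.toℕ a)) (multiple∈ (Fin.toℕ b)) eq ⟨
      Fin.toℕ a · κ                 ≈⟨ identityʳ _ ⟨
      Fin.toℕ a · κ + 0#            ∎)
    where
    open import Relation.Binary.Reasoning.Setoid setoid
    multiple∈ : ∀ n → n · κ ∈ elements i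
    multiple∈ zero    = K.0-closed i
    multiple∈ (suc n) = K.+-closed i κ∈ (multiple∈ n)

  -- Because κ has finite order, its inverse is a multiple m·κ, and `copies` realises that as an
  -- error on every tail.
  complement : ∀ {i κ} → κ ∈ elements i → (∀ n → Halving n κ) →
    ∃ λ κ⁻ → κ⁻ + κ ≈ 0# × ∀ n → Halving n κ⁻
  complement {κ = κ} κ∈ H =
    let m , 1+m·κ≈0 = torsion κ∈ in m · κ , trans (comm _ _) 1+m·κ≈0 , copies H m

  Escaping : ℕ → ℕ → Pred Carrier (c ⊔ ℓ)
  Escaping i n κ = ∃ λ (H : Halving n κ) → ¬ val (half H) ∈ elements i

  Escaping-resp : ∀ {i n} → Escaping i n Respects _≈_
  Escaping-resp κ≈κ′ (H , half∉) = Halving-resp κ≈κ′ H , half∉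

  -- Otherwise the tail would be Schur-free modulo G_i, which makes 𝒫(A) + G_i negligible.
  escaping-modulo : ∀ i n → ∃ λ κ → κ ∈ elements i × Escaping i n κ
  escaping-modulo i n = decidable-stable dec λ ¬escaping →
    positive i (negligible-tail i A n (schur-free⇒negligible i (Tail A n)
      λ { X P X⊑ P⊑ (κ , κ∈ , eq) → ∈⇒∼0 i (decidable-stable dec λ X∉ →
        ¬escaping (κ , κ∈ ,
          record { half = X ; whole = P ; half⊑ = X⊑ ; whole⊑ = P⊑ ; equation = eq } , X∉)) }))

  pigeonhole : ∀ {i} (Φ : ℕ → Pred Carrier (c ⊔ ℓ)) → (∀ n → Φ n Respects _≈_) →
    (∀ {m n κ} → m ℕ.≤ n → Φ n κ → Φ m κ) →
    (∀ n → ∃ λ κ → κ ∈ elements i × Φ n κ) → ∃ λ κ → κ ∈ elements i × (∀ n → Φ n κ)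
  pigeonhole {i} Φ Φ-resp antitone Φ∈ = Membership.find setoid
    (recurrent dec Φ antitone (elements i) λ n →
      let κ , κ∈ , Φκ = Φ∈ n in Membership.lose setoid (Φ-resp n) κ∈ Φκ)

  cancel∈ : ∀ {i x y} → x ∈ elements i → x + y ∈ elements i → y ∈ elements i
  cancel∈ {i} {x} {y} x∈ x+y∈ = K.respects i
    (trans (∙-congʳ (comm x y))
      (trans (assoc y x (- x)) (trans (∙-congˡ (inverseʳ x)) (identityʳ y))))
    (K.+-closed i x+y∈ (K.neg-closed i x∈))

  -- If 2x ∈ 𝒫 forces x ∈ G_j, then complements r with 2(r + x) ∈ 𝒫 place all
  -- the halves x of the same κ in one coset of G_j; two such halves on disjoint
  -- supports give 2x ≈ (x + x′) + (x - x′).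
  escaping-unbounded : ∀ {j n₀} → (∀ (H : Halving n₀ 0#) → val (half H) ∈ elements j) →
    ∀ n → ∃ λ κ → κ ∈ elements j × Escaping n n κ
  escaping-unbounded {j} {n₀} half∈ n =
    let κ , κ∈ , H∞ = pigeonhole {i} (Escaping i) (λ _ → Escaping-resp)
          (λ { m≤n (H , half∉) → Halving-antitone m≤n H , half∉ }) (escaping-modulo i)
        κ⁻ , κ⁻+κ≈0 , R∞ = complement κ∈ (proj₁ ∘ H∞)
        R = R∞ n₀
        N₁ = n ℕ.⊔ (n₀ ℕ.⊔ width R)
        H₁ , half₁∉ = H∞ N₁
        N₂ = N₁ ℕ.⊔ width H₁
        H₂ , _ = H∞ N₂
        n≤N₁ = ℕₚ.m≤m⊔n n (n₀ ℕ.⊔ width R)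
        N₁≤N₂ = ℕₚ.m≤m⊔n N₁ (width H₁)
        n₀⊔R≤N₁ = ℕₚ.m≤n⊔m n (n₀ ℕ.⊔ width R)
        n₀≤N₁ = ℕₚ.m⊔n≤o⇒m≤o n₀ (width R) n₀⊔R≤N₁
        R≤N₁ = ℕₚ.m⊔n≤o⇒n≤o n₀ (width R) n₀⊔R≤N₁
        H₁≤N₂ = ℕₚ.m≤n⊔m N₁ (width H₁)
        J₁ , J₁≈ = join-complement κ⁻+κ≈0 R H₁ n₀≤N₁ R≤N₁
        J₂ , J₂≈ = join-complement κ⁻+κ≈0 R H₂
          (ℕₚ.≤-trans n₀≤N₁ N₁≤N₂) (ℕₚ.≤-trans R≤N₁ N₁≤N₂)
    in
    val (half H₁) + - val (half H₂) ,
    K.respects j (difference (val (half R)) (val (half H₁)) (val (half H₂)))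
      (K.+-closed j (K.respects j J₁≈ (half∈ J₁))
        (K.neg-closed j (K.respects j J₂≈ (half∈ J₂)))) ,
    record
      { half     = half H₁
      ; whole    = half H₁ ∪ half H₂
      ; half⊑    = half⊑ (Halving-antitone n≤N₁ H₁)
      ; whole⊑   = ∪-⊑-Tail {X = half H₁} {half H₂} (ℕₚ.≤-trans n≤N₁ N₁≤N₂)
          (half⊑ (Halving-antitone n≤N₁ H₁)) (half⊑ H₂)
      ; equation = trans (double (val (half H₁)) (val (half H₂)))
          (∙-congʳ (sym (val-∪-Tail {N₂} {half H₁} {half H₂}
            (ℕₚ.m⊔n≤o⇒m≤o (bound (half H₁)) _ H₁≤N₂) (half⊑ H₂))))
      } ,
    half₁∉ ∘ ∈-ascending (ℕₚ.m≤m⊔n n j)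
    where
    open import Relation.Binary.Reasoning.Setoid setoid
    open import Algebra.Properties.CommutativeSemigroup commutativeSemigroup using (interchange)

    -- Large enough for G_n and G_j to be subgroups of G_i.
    i : ℕ
    i = n ℕ.⊔ j

    difference : ∀ r x y → (r + x) + - (r + y) ≈ x + - y
    difference r x y = begin
      (r + x) + - (r + y)       ≈⟨ ∙-congˡ (⁻¹-∙-comm r y) ⟨
      (r + x) + (- r + - y)     ≈⟨ interchange r x (- r) (- y) ⟩
      (r + - r) + (x + - y)     ≈⟨ ∙-congʳ (inverseʳ r) ⟩
      0# + (x + - y)            ≈⟨ identityˡ _ ⟩
      x + - y                   ∎

    double : ∀ x y → x + x ≈ (x + y) + (x + - y)
    double x y = sym (begin
      (x + y) + (x + - y)       ≈⟨ interchange x y x (- y) ⟩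
      (x + x) + (y + - y)       ≈⟨ ∙-congˡ (inverseʳ y) ⟩
      (x + x) + 0#              ≈⟨ identityʳ _ ⟩
      x + x                     ∎)

  -- If all exact halves lay in G_j, the second pigeonhole would fix one error κ in G_j with halves
  -- x outside every G_N. Joining a fixed complement with half r puts r + x in G_j, so x lies in any
  -- G_N that contains r and G_j.
  unbounded-halving : Unbounded G•
  unbounded-halving j n = decidable-stable dec λ bounded →
    let half∈ = λ H → decidable-stable (dec {val (half H) ∈ elements j})
          λ half∉ → bounded (H , half∉)
        κ , κ∈ , H∞ = pigeonhole {j} (λ m → Escaping m m) (λ _ → Escaping-resp)
          (λ { m≤n (H , half∉) → Halving-antitone m≤n H , half∉ ∘ ∈-ascending m≤n })
          (escaping-unbounded {j} {n} half∈)
        κ⁻ , κ⁻+κ≈0 , R∞ = complement κ∈ (proj₁ ∘ H∞)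
        R = R∞ n
        i , r∈ = ∈-eventually (val (half R))
        N = (i ℕ.⊔ j) ℕ.⊔ (n ℕ.⊔ width R)
        H , half∉ = H∞ N
        i⊔j≤N = ℕₚ.m≤m⊔n (i ℕ.⊔ j) (n ℕ.⊔ width R)
        n⊔R≤N = ℕₚ.m≤n⊔m (i ℕ.⊔ j) (n ℕ.⊔ width R)
        J , J≈ = join-complement κ⁻+κ≈0 R H
          (ℕₚ.m⊔n≤o⇒m≤o n (width R) n⊔R≤N) (ℕₚ.m⊔n≤o⇒n≤o n (width R) n⊔R≤N)
    in half∉ (cancel∈ {N} (∈-ascending (ℕₚ.m⊔n≤o⇒m≤o i j i⊔j≤N) r∈)
      (∈-ascending (ℕₚ.m⊔n≤o⇒n≤o i j i⊔j≤N) (K.respects j J≈ (half∈ J))))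

-- The infinite set

-- A positive rational is at least the reciprocal of its denominator; exceeding s therefore
-- contradicts density at most 1/`↧ₙ s`.
/-positive : ∀ s n d .⦃ _ : ℕ.NonZero d ⦄ → 0ℚᵘ ℚᵘ.< s → s ℚᵘ.< (ℤ.+ n ℚᵘ./ d) →
  d ℕ.< ℚᵘ.↧ₙ s ℕ.* n
/-positive (mkℚᵘ (ℤ.+ zero)   r) n (suc d) (*<* (ℤ.+<+ ())) _
/-positive (mkℚᵘ (ℤ.+ suc m)  r) n (suc d) _ (*<* s<n/d) = begin-strict
  suc d              ≤⟨ ℕₚ.m≤m+n (suc d) (m ℕ.* suc d) ⟩
  suc m ℕ.* suc d    <⟨ ℤₚ.drop‿+<+ (≡.subst (ℤ.+ (suc m ℕ.* suc d) ℤ.<_)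
                          (≡.sym (ℤₚ.pos-* n (suc r))) s<n/d) ⟩
  n ℕ.* suc r        ≡⟨ ℕₚ.*-comm n (suc r) ⟩
  suc r ℕ.* n        ∎
  where open ℕₚ.≤-Reasoning

-- Subset sums as values of index sets

module FiniteSums {c ℓ a} (G : AbelianGroup c ℓ) (e : ℕ → AbelianGroup.Carrier G)
  (e-injective : Injective _≡_ (AbelianGroup._≈_ G) e)
  (e-surjective : StrictlySurjective (AbelianGroup._≈_ G) e)
  (A : Pred (AbelianGroup.Carrier G) a) (A-resp : A Respects AbelianGroup._≈_ G)
  (I : Pred ℕ 0ℓ) (I⇒A : ∀ {k} → I k → A (e k)) (A⇒I : ∀ {k} → A (e k) → I k) where

  open Additive G
  open Sums G e hiding (Carrier; _≈_; setoid; _+_; 0#; -_)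

  𝒫-resp : 𝒫 A Respects _≈_
  𝒫-resp x≈y (F , unique , F⊆A , x≈F) = F , unique , F⊆A , trans (sym x≈y) x≈F

  𝒫⇒val : ∀ {x} → 𝒫 A x → ∃ λ X → X ⊑ I × x ≈ val X
  𝒫⇒val (F , unique , F⊆A , x≈F) =
    let X , X⊑I , F≈X , _ = go F unique F⊆A in X , X⊑I , trans x≈F F≈X
    where
    -- The last component keeps the index of the head out of X, since the head does not recur in the
    -- list.
    go : ∀ F → Unique F → All A F →
      ∃ λ X → X ⊑ I × sum F ≈ val X × (∀ {k} → X ∋ k → e k ∈ F)
    go [] _ _ = ∅ , (λ ()) , refl , λ ()
    go (y ∷ F) (y∉F ∷ unique) (y∈A ∷ F⊆A) =
      let X , X⊑I , F≈X , X⊆F = go F unique F⊆A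
          n , en≈y = e-surjective y
          n∉X = λ n∈X → All.lookupₛ setoid (λ u≈v y≉u y≈v → y≉u (trans y≈v (sym u≈v)))
            y∉F (X⊆F n∈X) (sym en≈y)
      in
      ⁅ n ⁆ ∪ X ,
      ∪-⊑ {⁅ n ⁆} {X} {I}
        (λ h → A⇒I (A-resp (trans (sym en≈y) (reflexive (≡.cong e (∋⁅⁆⇒≡ h)))) y∈A)) X⊑I ,
      trans (∙-cong (sym (trans (val-⁅⁆ n) en≈y)) F≈X)
        (sym (val-∪ ⁅ n ⁆ X λ h k∈X → n∉X (≡.subst (X ∋_) (≡.sym (∋⁅⁆⇒≡ h)) k∈X))) ,
      λ {k} → case n X en≈y X⊆F k
      where
      case : ∀ n X → e n ≈ y → (∀ {k} → X ∋ k → e k ∈ F) → ∀ k → ⁅ n ⁆ ∪ X ∋ k → e k ∈ y ∷ F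
      case n X en≈y X⊆F k h with ∪⁻ ⁅ n ⁆ X h
      ... | inj₁ h′  = here (trans (reflexive (≡.cong e (≡.sym (∋⁅⁆⇒≡ h′)))) en≈y)
      ... | inj₂ k∈X = there (X⊆F k∈X)

  val⇒𝒫 : ∀ {X x} → X ⊑ I → x ≈ val X → 𝒫 A x
  val⇒𝒫 {X} X⊑I x≈X =
    let F , unique , F⊆A , _ , X≈F = go (bound X) in F , unique , F⊆A , trans x≈X X≈F
    where
    -- The bound on the indices of the entries, with injectivity of `e`, makes `e n` a new entry.
    go : ∀ n → ∃ λ F → Unique F × All A F × All (λ y → ∃ λ k → k ℕ.< n × e k ≈ y) F ×
      combination (# ∘ has X) n ≈ sum F
    go zero    = [] , [] , [] , [] , refl
    go (suc n) with go n | has X n in eq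
    ... | F , unique , F⊆A , F<n , ∑≈F | false =
      F , unique , F⊆A , All.map (λ (k , k<n , ek≈y) → k , ℕₚ.m<n⇒m<1+n k<n , ek≈y) F<n ,
      trans (identityʳ _) ∑≈F
    ... | F , unique , F⊆A , F<n , ∑≈F | true =
      e n ∷ F ,
      All.map (λ (k , k<n , ek≈y) en≈y →
        ℕₚ.<⇒≢ k<n (e-injective (trans ek≈y (sym en≈y)))) F<n ∷ unique ,
      I⇒A (X⊑I (≡.subst T (≡.sym eq) _)) ∷ F⊆A ,
      (n , ℕₚ.≤-refl , refl) ∷
        All.map (λ (k , k<n , ek≈y) → k , ℕₚ.m<n⇒m<1+n k<n , ek≈y) F<n ,
      trans (∙-cong ∑≈F (identityʳ _)) (comm _ _)

-- Halves on disjoint supports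

module Construction {c ℓ g a} (G : AbelianGroup c ℓ) (G• : Additive.Filtration G g)
  (dec : ∀ {P : Set (c ⊔ ℓ)} → Dec P) (e : ℕ → AbelianGroup.Carrier G)
  (e-injective : Injective _≡_ (AbelianGroup._≈_ G) e)
  (e-surjective : StrictlySurjective (AbelianGroup._≈_ G) e)
  (A : Pred (AbelianGroup.Carrier G) a) (A-resp : A Respects AbelianGroup._≈_ G)
  (I : Pred ℕ 0ℓ) (I⇒A : ∀ {k} → I k → A (e k)) (A⇒I : ∀ {k} → A (e k) → I k)
  (unbounded-halving : Halvings.Unbounded G e I G•) where

  open Additive G
  open Filtration G• using (elements)
  open Sums G e using (val)
  open Halvings G e I
  open Counting G G• dec using (all∈-eventually; finiteSubgroup)
  open FiniteSums G e e-injective e-surjective A A-resp I I⇒A A⇒I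
  open AbelianGroup G using (refl; sym; trans; identityʳ; ∙-cong; comm)

  -- Each halving starts beyond the width of all earlier ones, so their supports are disjoint.
  start : ℕ → ℕ
  start zero    = 0
  start (suc k) = start k ℕ.⊔ Halving.width (proj₁ (unbounded-halving k (start k)))

  module H k = Halving (proj₁ (unbounded-halving k (start k)))

  b : ℕ → Carrier
  b k = val (H.half k)

  b∉ : ∀ k → ¬ b k ∈ elements k
  b∉ k = proj₂ (unbounded-halving k (start k))

  start-monotone : ∀ {k l} → k ℕ.≤ l → start k ℕ.≤ start l
  start-monotone {k} k≤l = go (ℕₚ.≤⇒≤′ k≤l)
    where
    go : ∀ {l} → k ℕ.≤′ l → start k ℕ.≤ start l
    go (ℕ.≤′-reflexive ≡.refl) = ℕₚ.≤-refl
    go (ℕ.≤′-step {l} k≤l) = ℕₚ.≤-trans (go k≤l) (ℕₚ.m≤m⊔n (start l) _)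

  B : Pred Carrier (c ⊔ ℓ ⊔ a)
  B x = 𝒫 A x × ∃ λ k → x ≈ b k

  B-resp : B Respects _≈_
  B-resp x≈y (x∈𝒫 , k , x≈b) = 𝒫-resp x≈y x∈𝒫 , k , trans (sym x≈y) x≈b

  b∈B : ∀ k → B (b k)
  b∈B k = val⇒𝒫 {H.half k} (proj₁ ∘ H.half⊑ k) refl , k , refl

  -- A finite list of elements lies in some G_i, which does not contain `b i`.
  B-infinite : Infinite B
  B-infinite B-finite =
    let i , bs⊆ = all∈-eventually (lookup (Finite.elements B-finite))
        b∈ = Equivalence.to (Finite.complete B-finite (b i)) (b∈B i)
    in b∉ i (Subgroup.respects (finiteSubgroup i) (sym (Anyₚ.lookup-index b∈))
      (bs⊆ ℕₚ.≤-refl (Any.index b∈)))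

  b+b∈𝒫 : ∀ {k l} → k ℕ.< l → 𝒫 A (b k + b l)
  b+b∈𝒫 {k} {l} k<l = val⇒𝒫 {H.half k ∪ H.half l}
    (∪-⊑ {H.half k} {H.half l} {I} (proj₁ ∘ H.half⊑ k) (proj₁ ∘ H.half⊑ l))
    (sym (val-∪-Tail {start l} {H.half k} {H.half l}
      (ℕₚ.≤-trans (ℕₚ.≤-trans (ℕₚ.m≤m⊔n _ _) (ℕₚ.m≤n⊔m (start k) _)) (start-monotone k<l))
      (H.half⊑ l)))

  -- Different indices have disjoint halves; for equal indices, the error-free halving equation
  -- gives the sum.
  B⊕B⊆𝒫 : B ⊕ B ⊆ 𝒫 A
  B⊕B⊆𝒫 {x} (y , y′ , (_ , k , y≈b) , (_ , l , y′≈b) , x≈y+y′)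
    with ℕₚ.<-cmp k l
  ... | tri< k<l _ _ = 𝒫-resp (sym (trans x≈y+y′ (∙-cong y≈b y′≈b))) (b+b∈𝒫 k<l)
  ... | tri> _ _ l<k = 𝒫-resp
    (sym (trans x≈y+y′ (trans (∙-cong y≈b y′≈b) (comm (b k) (b l))))) (b+b∈𝒫 l<k)
  ... | tri≈ _ ≡.refl _ = val⇒𝒫 {H.whole k} (proj₁ ∘ H.whole⊑ k)
    (trans x≈y+y′ (trans (∙-cong y≈b y′≈b) (trans (H.equation k) (identityʳ _))))

theorem7p1 : ∀ {c ℓ g a} (em : ExcludedMiddle (c ⊔ ℓ ⊔ a)) (G : AbelianGroup c ℓ) → let open Additive G in
    CountablyInfinite → LocallyFinite →
    (G• : Filtration g) →
    (A : Pred Carrier a) → A Respects _≈_ →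
    0ℚᵘ <ᴿ upperDensity G• {𝒫 A} (λ _ → em) →
    Σ[ B ∈ Pred Carrier (c ⊔ ℓ ⊔ a) ]
    B Respects _≈_ × Infinite B × B ⊆ 𝒫 A × B ⊕ B ⊆ 𝒫 A
theorem7p1 {c} {ℓ} {g} {a} em G enumeration _ G• A A-resp dense =
  B , B-resp , B-infinite , proj₁ , B⊕B⊆𝒫
  where
  open Additive G
  open Filtration G• using (order; order-nonZero)

  dec : ∀ {P : Set (c ⊔ ℓ)} → Dec P
  dec {P} = map′ lower lift (em {Lift (c ⊔ ℓ ⊔ a) P})

  e : ℕ → Carrier
  e = Bijection.to enumeration

  e-injective : Injective _≡_ _≈_ e
  e-injective = Bijection.injective enumeration

  e-surjective : StrictlySurjective _≈_ e
  e-surjective = Bijection.strictlySurjective enumeration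

  A∘e? : ∀ k → Dec (A (e k))
  A∘e? k = map′ lower lift (em {Lift (c ⊔ ℓ ⊔ a) (A (e k))})

  -- `True` lowers the predicate to level 0, whatever the level of `A`.
  I : Pred ℕ 0ℓ
  I k = True (A∘e? k)

  I⇒A : ∀ {k} → I k → A (e k)
  I⇒A {k} = toWitness {a? = A∘e? k}

  A⇒I : ∀ {k} → A (e k) → I k
  A⇒I {k} = fromWitness {a? = A∘e? k}

  open Counting G G• dec
  open Modulo G G• dec e e-injective using (Reach; Reach-resp; ≈⇒∼)
  open Sums G e using (trans; identityˡ)
  open FiniteSums G e e-injective e-surjective A A-resp I I⇒A A⇒I using (𝒫-resp; 𝒫⇒val)

  -- The positive upper density gives a rational s > 0 exceeded at arbitrarily late levels.
  -- Negligibility bounds the density by 1/`↧ₙ s` from i₀ on, and the level i₀ + k gives the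
  -- contradiction.
  positive : ∀ i → ¬ Negligible (Reach i I)
  positive i negligible = ℕₚ.<⇒≱
    (/-positive s (count 𝒫? j) (order j) ⦃ order-nonZero j ⦄ 0<s s<density)
    (ℕₚ.≤-trans (ℕₚ.*-monoʳ-≤ (ℚᵘ.↧ₙ s) 𝒫≤Reach) (proj₂ bound≤ (ℕₚ.m≤m+n i₀ k)))
    where
    s = proj₁ dense
    0<s = proj₁ (proj₂ dense)
    bound≤ = negligible (ℚᵘ.↧ₙ s)
    i₀ = proj₁ bound≤
    k = proj₁ (proj₂ (proj₂ dense) i₀)
    s<density = proj₂ (proj₂ (proj₂ dense) i₀)
    j = i₀ ℕ.+ k

    𝒫? : Decidable (𝒫 A)
    𝒫? _ = em

    𝒫≤Reach : count 𝒫? j ℕ.≤ ∣ Reach i I ∣ j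
    𝒫≤Reach = ≡.subst (ℕ._≤ ∣ Reach i I ∣ j) (ℕₚ.*-identityˡ (count 𝒫? j))
      -- A single translate, by `0#`, expresses the inclusion of 𝒫(A) in 𝒫(A) + G_i.
      (translates-count {1} 𝒫? (λ x → dec {Reach i I x}) 𝒫-resp (Reach-resp i) (λ _ → 0#)
        (λ _ x∈𝒫 → let X , X⊑I , x≈X = 𝒫⇒val x∈𝒫 in
          X , X⊑I , ≈⇒∼ i (trans (identityˡ _) x≈X))
        (λ { {Fin.zero} {Fin.zero} () })
        (λ _ → Subgroup.0-closed (finiteSubgroup j)))

  open UnboundedHalvings G G• dec e e-injective I positive using (unbounded-halving)
  open Construction G G• dec e e-injective e-surjective A A-resp I I⇒A A⇒I unbounded-halving
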